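{- Let $k\geq 4$ and $2\leq d\leq k-2$. Let $X_{k,d}^2$ consist of the three patterns $321$, $(d+1,d+2,\dots,k-1,1,k,2,3,\dots,d)$ and $(d+1,d+2,\dots,k-1,k,1,2,\dots,d)$, and let $x_{k,d}^2(n)$ be the number of permutations in $S_n$ avoiding all patterns of $X_{k,d}^2$. Then for all $n\geq k$, $$\sum_{j=0}^{k-1}(-1)^j\binom{k-1-j}{j}x_{k,d}^2(n-j)=\sum_{j=0}^{k-1}(-1)^j\binom{k-1-j}{j}x_{k,d}^2(n-1-j)+\sum_{j=0}^{k-4}(-1)^j\binom{k-4-j}{j}x_{k,d}^2(n-3-j),$$ $x_{k,d}^2(n)=\frac{1}{n+1}\binom{2n}{n}$ for all $0\leq n\leq k-1$, and $$\sum_{n\geq0}x_{k,d}^2(n)x^n=\dfrac{U_{k-1}\left(\frac{1}{2\sqrt{x}}\right)+xU_{k-3}\left(\frac{1}{2\sqrt{x}}\right)}{\sqrt{x}\left[U_k\left(\frac{1}{2\sqrt{x}}\right)+xU_{k-2}\left(\frac{1}{2\sqrt{x}}\right)\right]}.$$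
   Context: A permutation $\alpha\in S_n$ contains a pattern $\tau\in S_m$ if there are indices $i_1<\dots<i_m$ with $(\alpha_{i_1},\dots,\alpha_{i_m})$ order-isomorphic to $\tau$; otherwise it avoids $\tau$. $U_m$ is the Chebyshev polynomial of the second kind, $U_m(\cos\theta)=\sin((m+1)\theta)/\sin\theta$. -}

module Defs where

open import Data.Nat as ℕ using (ℕ; zero; suc; _+_; _∸_; _<_; _≤_; _^_)
open import Data.Fin using (Fin; toℕ)
open import Data.Vec using (Vec; lookup)
open import Data.List using (List; []; _∷_; _++_; map; upTo; length; sum)
import Data.List as List
open import Data.Product using (Σ; _×_)
open import Data.Integer as ℤ using (ℤ; +_)
open import Data.Rational as ℚ using (ℚ)
open import Relation.Nullary using (¬_)
open import Relation.Binary.PropositionalEquality using (_≡_)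
open import Function.Bundles using (_⇔_)

IsPerm : {n : ℕ} → Vec (Fin n) n → Set
IsPerm {n} α = ∀ (i j : Fin n) → lookup α i ≡ lookup α j → i ≡ j

-- Patterns are given as lists of naturals (values as in the paper, 1-based;
-- only their relative order matters).
-- α contains τ (of length m) iff there are indices i₁<…<i_m with
-- (α_{i₁},…,α_{i_m}) order-isomorphic to τ.
Contains : {n : ℕ} → Vec (Fin n) n → List ℕ → Set
Contains {n} α τ =
  Σ (Fin (length τ) → Fin n) λ ι →
    (∀ a b → toℕ a < toℕ b → toℕ (ι a) < toℕ (ι b)) ×
    (∀ a b → (toℕ (lookup α (ι a)) < toℕ (lookup α (ι b))) ⇔ (List.lookup τ a < List.lookup τ b))

Avoids : {n : ℕ} → Vec (Fin n) n → List ℕ → Set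
Avoids α τ = ¬ Contains α τ

pat321 : List ℕ
pat321 = 3 ∷ 2 ∷ 1 ∷ []

block : ℕ → ℕ → List ℕ
block k d = map (λ i → suc d + i) (upTo (k ∸ 1 ∸ d))

patA : ℕ → ℕ → List ℕ
patA k d = block k d ++ (1 ∷ k ∷ map (λ i → 2 + i) (upTo (d ∸ 1)))

patB : ℕ → ℕ → List ℕ
patB k d = block k d ++ (k ∷ map suc (upTo d))

-- Permutations in S_n avoiding every pattern of X²_{k,d}.
-- Proof fields are irrelevant, so two elements are equal iff their
-- one-line notations are equal: this is exactly the set being counted.
record AvoidingPerm (k d n : ℕ) : Set where
  constructor mkAP
  field
    perm    : Vec (Fin n) n
    .isPerm : IsPerm perm
    .av321  : Avoids perm pat321
    .avA    : Avoids perm (patA k d)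
    .avB    : Avoids perm (patB k d)

Σℤ< : ℕ → (ℕ → ℤ) → ℤ
Σℤ< m f = List.foldr ℤ._+_ (+ 0) (map f (upTo m))

Σℚ< : ℕ → (ℕ → ℚ) → ℚ
Σℚ< m f = List.foldr ℚ._+_ ℚ.0ℚ (map f (upTo m))

sign : ℕ → ℤ
sign zero = + 1
sign (suc j) = ℤ.- sign j

-- Chebyshev polynomials of the second kind, U_m(t), as coefficient
-- functions: chebU m i = coefficient of t^i in U_m.
-- U_0 = 1, U_1 = 2t, U_{m+2} = 2t U_{m+1} - U_m.
chebU : ℕ → ℕ → ℤ
chebU zero zero = + 1
chebU zero (suc i) = + 0
chebU (suc zero) zero = + 0
chebU (suc zero) (suc zero) = + 2
chebU (suc zero) (suc (suc i)) = + 0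
chebU (suc (suc m)) zero = ℤ.- chebU m zero
chebU (suc (suc m)) (suc i) = (+ 2) ℤ.* chebU (suc m) i ℤ.- chebU m (suc i)

halfPow : ℕ → ℚ
halfPow zero = ℚ.1ℚ
halfPow (suc i) = ℚ.½ ℚ.* halfPow i

-- For a polynomial p(t) of degree ≤ m (given by coefficients),
-- subHalf m p j = coefficient of x^j in the polynomial (√x)^m · p(1/(2√x))
--             = Σ_i p_i 2^{-i} (√x)^{m-i}
-- (only terms with m - i even contribute for the U's; we take exactly
--  the coefficient of x^j, namely i = m - 2j).
subHalf : ℕ → (ℕ → ℤ) → ℕ → ℚ
subHalf m p j with (j + j) ℕ.≤? m
... | Relation.Nullary.yes _ = ℚ._*_ (p (m ∸ (j + j)) ℚ./ 1) (halfPow (m ∸ (j + j)))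
... | Relation.Nullary.no _ = ℚ.0ℚ

shift2 : (ℕ → ℚ) → ℕ → ℚ
shift2 q zero = ℚ.0ℚ
shift2 q (suc zero) = ℚ.0ℚ
shift2 q (suc (suc j)) = q j

-- Numerator, cleared by (√x)^{k-1}:
--   (√x)^{k-1} [U_{k-1}(1/(2√x)) + x U_{k-3}(1/(2√x))]
--   = V_{k-1}(x) + x² V_{k-3}(x),   V_m(x) := (√x)^m U_m(1/(2√x)).
numer : ℕ → ℕ → ℚ
numer k j = subHalf (k ∸ 1) (chebU (k ∸ 1)) j ℚ.+ shift2 (subHalf (k ∸ 3) (chebU (k ∸ 3))) j

-- Denominator, cleared by the same factor (√x)^{k-1}:
--   (√x)^{k-1} · √x [U_k(1/(2√x)) + x U_{k-2}(1/(2√x))] = V_k(x) + x² V_{k-2}(x).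
denom : ℕ → ℕ → ℚ
denom k j = subHalf k (chebU k) j ℚ.+ shift2 (subHalf (k ∸ 2) (chebU (k ∸ 2))) j

convℚ : (ℕ → ℚ) → (ℕ → ℚ) → ℕ → ℚ
convℚ a b n = Σℚ< (suc n) (λ i → a i ℚ.* b (n ∸ i))

{-# OPTIONS --safe #-}
module Submission where

-- A 321-avoiding permutation is the union of its left-to-right maxima and of the remaining entries, and
-- both increase; so it is determined by the word P marking the positions of the maxima and the word V
-- marking their values.  Let a i (b i) be the number of maxima to the left of (below) the i-th remaining
-- entry.  A pair of words with equally many maxima comes from a permutation iff b i < a i for all i, and,
-- with d = e + 2 and k - d = m + 1, one of the two long patterns occurs iff b (i+e+1) + m ≤ a i and
-- b (i+e+1) + m < a (i+1) for some i.
--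
-- Reading P and V with two heads, V being ahead by e remaining entries once that is possible, makes the
-- second condition local, and an automaton recognises the admissible pairs.  Its states carry a height,
-- and the series y j of the pairs accepted from height j (rescaled by a power of x) satisfy
-- y 1 = y 0 - 1 and y (j+1) = y j - x y (j-1) for j < k - 4, whatever the value of d.  This is the
-- Chebyshev recursion; solving it against the equations at the top height gives the generating function.

open import Defs
open import Data.Bool as Bool using (Bool; true; false; not)
open import Data.Empty using (⊥; ⊥-elim)
open import Data.Empty.Irrelevant renaming (⊥-elim to ⊥-elim-irr)
open import Data.Fin as Fin using (Fin; toℕ; fromℕ<; punchOut)
open import Data.Fin.Permutation using (↔⇒≡)
open import Data.Fin.Properties using
  (toℕ<n; toℕ-fromℕ<; toℕ-injective; any?; punchOut-injective; injective⇒≤; +↔⊎; 0↔⊥; 1↔⊤)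
open import Data.List as List using (List; []; _∷_; _++_; length; applyUpTo; map; upTo; foldr)
import Data.List.Properties as Listₚ
open import Data.List.Relation.Unary.All using (All; []; _∷_)
open import Data.List.Relation.Unary.Linked using (Linked; []; [-]; _∷_)
open import Data.Product using (_×_; _,_; proj₁; proj₂; ∃-syntax)
open import Data.Sum using (_⊎_; inj₁; inj₂; [_,_]′)
open import Data.Sum.Function.Propositional using (_⊎-↔_)
open import Data.Unit using (⊤; tt)
open import Data.Vec using (Vec; []; _∷_; lookup; tabulate)
import Data.Vec.Properties as Vecₚ
open import Function.Bundles using (_⇔_; mk⇔; Equivalence; _↔_; mk↔ₛ′)
open import Function.Properties.Inverse using (↔-trans; ↔-sym)
open import Relation.Binary.Definitions using (tri<; tri≈; tri>)
open import Relation.Binary.PropositionalEquality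
open import Relation.Nullary using (¬_; contradiction; yes; no; Dec; does)
open import Relation.Nullary.Decidable using (_×-dec_; does-⇔; recompute)

-- The two long patterns have the same m + 1 upper and e + 2 lower letters and differ only in the
-- order of 1 and k. An occurrence of either means m maxima before the first lower entry and m + 1
-- before the second: these are the two inequalities. The lower entries may be taken consecutive
-- among the remaining ones, whence the index i + e + 1. The obstacle is that this compares P near
-- entry i with V at entry i + e + 1. With the heads e entries apart, it only involves the
-- difference of the numbers of maxima passed by them, and b i < a i is automatic for an entry that
-- V passes while this difference is positive. Each state dictates which head moves, so an
-- admissible pair has exactly one run and every transition is a bijection. While the lag is below
-- e, P passes a remaining entry only when it has no maximum in hand, and then steepness is
-- impossible. Lag j and lead r thus grow one after the other and form one height j + r; the two
-- ranges enter only through e + m' = k - 4, which is why d disappears.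

module Bijections where

  open import Data.Nat using (ℕ; zero; suc; pred; _+_; _∸_; _≤_; _<_; z≤n; s≤s; _<?_)
  open import Data.Nat.Properties

  -- The automaton recognising admissible pairs of words

  cnt : Bool → List Bool → ℕ
  cnt b [] = 0
  cnt true (true ∷ w) = suc (cnt true w)
  cnt true (false ∷ w) = cnt true w
  cnt false (true ∷ w) = cnt false w
  cnt false (false ∷ w) = suc (cnt false w)

  -- The number of letters true before the i-th letter false (all of them, if i is too large).
  ahead : List Bool → ℕ → ℕ
  ahead [] i = 0
  ahead (true ∷ w) i = suc (ahead w i)
  ahead (false ∷ w) zero = 0
  ahead (false ∷ w) (suc i) = ahead w i

  module Machine (e m' : ℕ) where

    m : ℕ
    m = suc m'

    -- Core describes the unread suffixes P and V when the head of V is ahead by j remaining entries and the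
    -- head of P is ahead by r maxima, with g = e - j; all counts restart at the heads.
    -- Edge is the case of `gentle` in which the first of the two entries is the last one read in P.
    Steep : (r b a a⁺ : ℕ) → Set
    Steep r b a a⁺ = b + m ≤ r + a × b + m < r + a⁺

    record Core (j g r : ℕ) (P V : List Bool) : Set where
      constructor core
      field
        trues  : r + cnt true P ≡ cnt true V
        falses : cnt false P ≡ j + cnt false V
        above  : ∀ i → i < cnt false V → ahead V i < r + ahead P (j + i)
        gentle : ∀ i → suc g + i < cnt false V →
                 ¬ Steep r (ahead V (suc g + i)) (ahead P i) (ahead P (suc i))
    open Core

    Edge : ℕ → List Bool → List Bool → Set
    Edge r P V = 0 < cnt false V → ¬ Steep r (ahead V 0) 0 (ahead P 0)

    Steep-suc : ∀ r {b a a⁺} → Steep r b (suc a) (suc a⁺) → Steep (suc r) b a a⁺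
    Steep-suc r {a = a} {a⁺} (p , q) = ≤-trans p (≤-reflexive (+-suc r a)) , ≤-trans q (≤-reflexive (+-suc r a⁺))

    Steep-suc⁻ : ∀ r {b a a⁺} → Steep (suc r) b a a⁺ → Steep r b (suc a) (suc a⁺)
    Steep-suc⁻ r {a = a} {a⁺} (p , q) = ≤-trans p (≤-reflexive (sym (+-suc r a))) , ≤-trans q (≤-reflexive (sym (+-suc r a⁺)))

    -- Since `m` is positive, steepness requires a lead of P in maxima. A remaining entry met at
    -- lead 0 is therefore unconstrained.
    ¬Steep-0 : ∀ {b a⁺} → ¬ Steep 0 b 0 a⁺
    ¬Steep-0 {b} (p , _) with () ← subst (_≤ 0) (+-suc b m') p

    Edge-0 : ∀ {P V} → Edge 0 P V
    Edge-0 {V = V} _ = ¬Steep-0 {ahead V 0}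

    -- A maximum moves from the unread part of P into the lead; every condition depends only on the
    -- sum of the two.
    shift : ∀ {j g r P V} → Core j g r (true ∷ P) V → Core j g (suc r) P V
    shift {j} {g} {r} {P} {V} (core t f a c) = core
      (trans (sym (+-suc r _)) t) f
      (λ i l → ≤-trans (a i l) (≤-reflexive (+-suc r _)))
      (λ i l s → c i l (Steep-suc⁻ r s))

    shift⁻ : ∀ {j g r P V} → Core j g (suc r) P V → Core j g r (true ∷ P) V
    shift⁻ {j} {g} {r} {P} {V} (core t f a c) = core
      (trans (+-suc r _) t) f
      (λ i l → ≤-trans (a i l) (≤-reflexive (sym (+-suc r _))))
      (λ i l s → c i l (Steep-suc r s))

    drop : ∀ {j g r P V} → Core j g (suc r) P (true ∷ V) → Core j g r P V
    drop (core t f a c) = core (suc-injective t) f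
      (λ i l → ≤-pred (a i l)) (λ i l (p , q) → c i l (s≤s p , s≤s q))

    drop⁻ : ∀ {j g r P V} → Core j g r P V → Core j g (suc r) P (true ∷ V)
    drop⁻ (core t f a c) = core (cong suc t) f
      (λ i l → s≤s (a i l)) (λ i l (p , q) → c i l (≤-pred p , ≤-pred q))

    fill : ∀ {j g P V} → Core (suc j) g 0 (false ∷ P) V → Core j (suc g) 0 P V
    fill {j} {g} {P} {V} (core t f a c) = core t (suc-injective f) a
      (λ i l → subst (λ z → z < cnt false V → ¬ Steep 0 (ahead V z) (ahead P i) (ahead P (suc i)))
                 (+-suc (suc g) i) (c (suc i)) l)

    fill⁻ : ∀ {j g P V} → Core j (suc g) 0 P V → Core (suc j) g 0 (false ∷ P) V
    fill⁻ {j} {g} {P} {V} (core t f a c) = core t (cong suc f) a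
      -- The new instance concerns the entry that P reads now, at lead 0.
      λ { zero l s → ¬Steep-0 {ahead V (suc g + 0)} {ahead P 0} s
        ; (suc i) l → subst (λ z → z < cnt false V → ¬ Steep 0 (ahead V z) (ahead P i) (ahead P (suc i)))
                 (sym (+-suc (suc g) i)) (c i) l }

    skip : ∀ {j g r P V} → Core j (suc g) r P (false ∷ V) → Core (suc j) g r P V
    skip {j} {g} {r} {P} {V} (core t f a c) = core t (trans f (+-suc j _))
      (λ i l → subst (λ z → ahead V i < r + ahead P z) (+-suc j i) (a (suc i) (s≤s l)))
      (λ i l → c i (s≤s l))

    -- The lead has the form `suc r`, which makes the new instance of `above` automatic: no unread
    -- maximum of V lies below the value being read, while P has already passed a maximum that V has
    -- yet to meet.
    skip⁻ : ∀ {j g r P V} → Core (suc j) g (suc r) P V → Core j (suc g) (suc r) P (false ∷ V)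
    skip⁻ {j} {g} {r} {P} {V} (core t f a c) = core t (trans f (sym (+-suc j _)))
      (λ { zero l → s≤s z≤n
         ; (suc i) l → subst (λ z → ahead V i < suc r + ahead P z) (sym (+-suc j i)) (a i (≤-pred l)) })
      (λ i l → c i (≤-pred l))

    -- At full lag both heads pass a remaining entry together. Instance 0 of `gentle` then starts at
    -- an entry that P has already read, so it leaves `Core` and survives as `Edge`.
    turn : ∀ {j r P V} → Core j 0 r (false ∷ P) (false ∷ V) → Core j 0 r P V × Edge r P V
    turn {j} {r} {P} {V} (core t f a c) = core t (suc-injective (trans f (+-suc j _)))
      (λ i l → subst (λ z → ahead V i < r + ahead (false ∷ P) z) (+-suc j i) (a (suc i) (s≤s l)))
      (λ i l → c (suc i) (s≤s l))
      , λ l → c 0 (s≤s l)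

    turn⁻ : ∀ {j r P V} → Core j 0 (suc r) P V → Edge (suc r) P V →
            Core j 0 (suc r) (false ∷ P) (false ∷ V)
    turn⁻ {j} {r} {P} {V} (core t f a c) d = core t (trans (cong suc f) (sym (+-suc j _)))
      (λ { zero l → s≤s z≤n
         ; (suc i) l → subst (λ z → ahead V i < suc r + ahead (false ∷ P) z) (sym (+-suc j i)) (a i (≤-pred l)) })
      (λ { zero l → d (≤-pred l) ; (suc i) l → c i (≤-pred l) })

    Edge-drop : ∀ {r P V} → Edge (suc r) P (true ∷ V) → Edge r P V
    Edge-drop d l (p , q) = d l (s≤s p , s≤s q)

    Edge-drop⁻ : ∀ {r P V} → Edge r P V → Edge (suc r) P (true ∷ V)
    Edge-drop⁻ d l (p , q) = d l (≤-pred p , ≤-pred q)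

    -- When V faces a remaining entry, `Edge` depends on how the lead compares with `m`: it holds
    -- below `m`; at `m` it holds if P faces a remaining entry and fails if P faces a maximum; above
    -- `m` it fails. This and the three lemmas that follow are the origin of the states `hi` and
    -- `top`.
    Edge-below : ∀ {r q P V} → r + suc q ≡ m → Edge r P (false ∷ V)
    Edge-below {r} {q} eq _ (p , _) =
      <⇒≱ (≤-trans (m<m+n r (s≤s z≤n)) (≤-reflexive eq)) (subst (m ≤_) (+-identityʳ r) p)

    Edge-false : ∀ {r P V} → r + 0 ≡ m → Edge r (false ∷ P) (false ∷ V)
    Edge-false {r} eq _ (_ , q) = <-irrefl (sym eq) q

    ¬Edge-true : ∀ {r P V} → r + 0 ≡ m → ¬ Edge r (true ∷ P) (false ∷ V)
    ¬Edge-true {r} {P} eq d = d (s≤s z≤n)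
      ( ≤-reflexive (sym eq)
      , ≤-trans (s≤s (≤-reflexive (sym eq))) (≤-trans (≤-reflexive (sym (+-suc r 0))) (+-monoʳ-≤ r (s≤s z≤n))))

    ¬Edge-above : ∀ {x P V} → ¬ Edge (suc m + x) P (false ∷ V)
    ¬Edge-above {x} {P} d = d (s≤s z≤n)
      (≤-trans (n≤1+n m) (≤-trans (m≤m+n (suc m) x) (m≤m+n _ 0)) , ≤-trans (m≤m+n (suc m) x) (m≤m+n _ (ahead P 0)))

    -- Without lag or lead, every maximum that P has passed lies below the remaining entry at its
    -- head, so nothing to the left of that entry exceeds it.
    ¬Core-F : ∀ {g P V} → ¬ Core 0 g 0 (false ∷ P) V
    ¬Core-F {V = V} (core t f a c) with () ← a 0 (subst (0 <_) f (s≤s z≤n))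

    ¬Core-V[] : ∀ {j g r P} → ¬ Core j g (suc r) P []
    ¬Core-V[] (core () f a c)

    ¬Core-P[] : ∀ {j g r V} → ¬ Core j g r [] (false ∷ V)
    ¬Core-P[] {j} (core t f a c) with () ← trans f (+-suc j _)

    ¬Core-V∷ : ∀ {g V} → ¬ Core 0 g 0 [] (true ∷ V)
    ¬Core-V∷ (core () _ _ _)

    ¬Core-suc : ∀ {j g r V} → ¬ Core (suc j) g r [] V
    ¬Core-suc (core _ () _ _)

    Core-[] : ∀ {g} → Core 0 g 0 [] []
    Core-[] = core refl refl (λ _ ()) (λ _ ())

    -- lo j g: V is j = e - g remaining entries ahead; loR: moreover P has read a maximum that V has not met.
    -- hi r q and top x: V is e remaining entries ahead and P is r = m - q, respectively m + 1 + x, maxima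
    -- ahead.  xp r q (with r + 1 maxima) and xpt x: V has read one more remaining entry, to be met by P.
    data State : Set where
      lo loR hi xp : ℕ → ℕ → State
      top xpt : ℕ → State

    -- In `xp` and `xpt` the entry that V has passed in advance is kept as a letter `false` in front
    -- of V, so that the lag in `Core` never exceeds `e`. No `Edge` is stored there: it was settled
    -- when V passed that letter.
    Inv : State → List Bool → List Bool → Set
    Inv (lo j g) P V = j + g ≡ e × Core j g 0 P V
    Inv (loR j g) P V = j + g ≡ e × Core j g 1 P V
    Inv (hi r q) P V = r + q ≡ m × Core e 0 r P V × Edge r P V
    Inv (xp r q) P V = suc r + q ≡ m × Core e 0 (suc r) P (false ∷ V)
    Inv (top x) P V = Core e 0 (suc m + x) P V × Edge (suc m + x) P V
    Inv (xpt x) P V = Core e 0 (suc m + x) P (false ∷ V)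

    -- Only P has a prescribed length; the counts in the invariant then fix that of V. Irrelevance
    -- of the proofs makes two elements equal as soon as their words are.
    record Accept (s : State) (p : ℕ) : Set where
      constructor acc
      field
        P V  : List Bool
        .len : length P ≡ p
        .inv : Inv s P V

    drop-hi : ∀ {r q P V} → Inv (hi (suc r) q) P (true ∷ V) → Inv (hi r (suc q)) P V
    drop-hi {r} {q} {P} {V} (eq , c , d) = trans (+-suc r q) eq , drop c , Edge-drop {r} {P} {V} d

    drop-hi⁻ : ∀ {r q P V} → Inv (hi r (suc q)) P V → Inv (hi (suc r) q) P (true ∷ V)
    drop-hi⁻ {r} {q} {P} {V} (eq , c , d) = trans (sym (+-suc r q)) eq , drop⁻ c , Edge-drop⁻ {r} {P} {V} d

    turn-flat⁻ : ∀ {r P V} → Inv (hi (suc r) 0) P V → Inv (hi (suc r) 0) (false ∷ P) (false ∷ V)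
    turn-flat⁻ {r} {P} {V} (eq , c , d) = eq , turn⁻ c d , Edge-false {suc r} {P} {V} eq

    climb-top : ∀ {r s P V} → suc r ≡ suc m + s → Core e 0 r (true ∷ P) V → Core e 0 (suc m + s) P V
    climb-top {P = P} {V} eq c = subst (λ z → Core e 0 z P V) eq (shift c)

    climb-top⁻ : ∀ {r s P V} → suc r ≡ suc m + s → Core e 0 (suc m + s) P V → Core e 0 r (true ∷ P) V
    climb-top⁻ {P = P} {V} eq c = shift⁻ (subst (λ z → Core e 0 z P V) (sym eq) c)

    stop : ∀ g → g ≡ e → Accept (lo 0 g) 0 ↔ ⊤
    stop g eq = mk↔ₛ′ (λ _ → tt) (λ _ → acc [] [] refl (eq , Core-[])) (λ _ → refl)
      λ { (acc [] [] l i) → refl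
        ; (acc [] (true ∷ V) l i) → ⊥-elim-irr (¬Core-V∷ (proj₂ i))
        ; (acc [] (false ∷ V) l i) → ⊥-elim-irr (¬Core-P[] (proj₂ i))
        ; (acc (_ ∷ _) V () i) }

    lo-[] : ∀ j g → Accept (lo (suc j) g) 0 ↔ ⊥
    lo-[] j g = mk↔ₛ′ (λ { (acc [] V l i) → ⊥-elim-irr (¬Core-suc (proj₂ i)) ; (acc (_ ∷ _) V () i) }) (λ ()) (λ ())
      λ { (acc [] V l i) → ⊥-elim-irr (¬Core-suc (proj₂ i)) ; (acc (_ ∷ _) V () i) }

    rise : ∀ g p → Accept (lo 0 g) (suc p) ↔ Accept (loR 0 g) p
    rise g p = mk↔ₛ′
      (λ { (acc [] V () i)
         ; (acc (true ∷ P) V l i) → acc P V (suc-injective l) (proj₁ i , shift (proj₂ i))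
         ; (acc (false ∷ P) V l i) → ⊥-elim-irr (¬Core-F (proj₂ i)) })
      (λ { (acc P V l i) → acc (true ∷ P) V (cong suc l) (proj₁ i , shift⁻ (proj₂ i)) })
      (λ _ → refl)
      λ { (acc [] V () i) ; (acc (true ∷ P) V l i) → refl
        ; (acc (false ∷ P) V l i) → ⊥-elim-irr (¬Core-F (proj₂ i)) }

    fill-or-rise : ∀ j g p → Accept (lo (suc j) g) (suc p) ↔
                             (Accept (lo j (suc g)) p ⊎ Accept (loR (suc j) g) p)
    fill-or-rise j g p = mk↔ₛ′
      (λ { (acc [] V () i)
         ; (acc (false ∷ P) V l i) → inj₁ (acc P V (suc-injective l) (trans (+-suc j g) (proj₁ i) , fill (proj₂ i)))
         ; (acc (true ∷ P) V l i) → inj₂ (acc P V (suc-injective l) (proj₁ i , shift (proj₂ i))) })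
      (λ { (inj₁ (acc P V l i)) → acc (false ∷ P) V (cong suc l) (trans (sym (+-suc j g)) (proj₁ i) , fill⁻ (proj₂ i))
         ; (inj₂ (acc P V l i)) → acc (true ∷ P) V (cong suc l) (proj₁ i , shift⁻ (proj₂ i)) })
      (λ { (inj₁ _) → refl ; (inj₂ _) → refl })
      λ { (acc [] V () i) ; (acc (true ∷ P) V l i) → refl ; (acc (false ∷ P) V l i) → refl }

    meet-or-skip : ∀ j g p → Accept (loR j (suc g)) p ↔ (Accept (lo j (suc g)) p ⊎ Accept (loR (suc j) g) p)
    meet-or-skip j g p = mk↔ₛ′
      (λ { (acc P [] l i) → ⊥-elim-irr (¬Core-V[] (proj₂ i))
         ; (acc P (true ∷ V) l i) → inj₁ (acc P V l (proj₁ i , drop (proj₂ i)))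
         ; (acc P (false ∷ V) l i) → inj₂ (acc P V l (trans (sym (+-suc j g)) (proj₁ i) , skip (proj₂ i))) })
      (λ { (inj₁ (acc P V l i)) → acc P (true ∷ V) l (proj₁ i , drop⁻ (proj₂ i))
         ; (inj₂ (acc P V l i)) → acc P (false ∷ V) l (trans (+-suc j g) (proj₁ i) , skip⁻ (proj₂ i)) })
      (λ { (inj₁ _) → refl ; (inj₂ _) → refl })
      λ { (acc P [] l i) → ⊥-elim-irr (¬Core-V[] (proj₂ i))
        ; (acc P (true ∷ V) l i) → refl ; (acc P (false ∷ V) l i) → refl }

    meet-or-enter : ∀ p → Accept (loR e 0) p ↔ (Accept (lo e 0) p ⊎ Accept (xp 0 m') p)
    meet-or-enter p = mk↔ₛ′
      (λ { (acc P [] l i) → ⊥-elim-irr (¬Core-V[] (proj₂ i))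
         ; (acc P (true ∷ V) l i) → inj₁ (acc P V l (proj₁ i , drop (proj₂ i)))
         ; (acc P (false ∷ V) l i) → inj₂ (acc P V l (refl , proj₂ i)) })
      (λ { (inj₁ (acc P V l i)) → acc P (true ∷ V) l (proj₁ i , drop⁻ (proj₂ i))
         ; (inj₂ (acc P V l i)) → acc P (false ∷ V) l (+-identityʳ e , proj₂ i) })
      (λ { (inj₁ _) → refl ; (inj₂ _) → refl })
      λ { (acc P [] l i) → ⊥-elim-irr (¬Core-V[] (proj₂ i))
        ; (acc P (true ∷ V) l i) → refl ; (acc P (false ∷ V) l i) → refl }

    leave : ∀ p → Accept (hi 0 m) p ↔ Accept (lo e 0) p
    leave p = mk↔ₛ′
      (λ { (acc P V l i) → acc P V l (+-identityʳ e , proj₁ (proj₂ i)) })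
      (λ { (acc P V l i) → acc P V l (refl , proj₂ i , Edge-0 {P} {V}) })
      (λ _ → refl) (λ _ → refl)

    drop-or-hook : ∀ r q p → Accept (hi (suc r) (suc q)) p ↔ (Accept (hi r (suc (suc q))) p ⊎ Accept (xp r (suc q)) p)
    drop-or-hook r q p = mk↔ₛ′
      (λ { (acc P [] l i) → ⊥-elim-irr (¬Core-V[] (proj₁ (proj₂ i)))
         ; (acc P (true ∷ V) l i) → inj₁ (acc P V l (drop-hi i))
         ; (acc P (false ∷ V) l i) → inj₂ (acc P V l (proj₁ i , proj₁ (proj₂ i))) })
      (λ { (inj₁ (acc P V l i)) → acc P (true ∷ V) l (drop-hi⁻ i)
         ; (inj₂ (acc P V l i)) → acc P (false ∷ V) l (proj₁ i , proj₂ i , Edge-below {suc r} {q} {P} {V} (proj₁ i)) })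
      (λ { (inj₁ _) → refl ; (inj₂ _) → refl })
      λ { (acc P [] l i) → ⊥-elim-irr (¬Core-V[] (proj₁ (proj₂ i)))
        ; (acc P (true ∷ V) l i) → refl ; (acc P (false ∷ V) l i) → refl }

    drop-last : ∀ r → Accept (hi (suc r) 0) 0 ↔ Accept (hi r 1) 0
    drop-last r = mk↔ₛ′
      (λ { (acc P [] l i) → ⊥-elim-irr (¬Core-V[] (proj₁ (proj₂ i)))
         ; (acc P (true ∷ V) l i) → acc P V l (drop-hi i)
         ; (acc [] (false ∷ V) l i) → ⊥-elim-irr (¬Core-P[] (proj₁ (proj₂ i)))
         ; (acc (_ ∷ _) (false ∷ V) () i) })
      (λ { (acc P V l i) → acc P (true ∷ V) l (drop-hi⁻ i) })
      (λ _ → refl)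
      λ { (acc P [] l i) → ⊥-elim-irr (¬Core-V[] (proj₁ (proj₂ i)))
        ; (acc P (true ∷ V) l i) → refl
        ; (acc [] (false ∷ V) l i) → ⊥-elim-irr (¬Core-P[] (proj₁ (proj₂ i)))
        ; (acc (_ ∷ _) (false ∷ V) () i) }

    -- At lead exactly `m`, `Edge` lets V pass a remaining entry only together with P, which changes
    -- neither lag nor lead.
    drop-or-flat : ∀ r p → Accept (hi (suc r) 0) (suc p) ↔ (Accept (hi r 1) (suc p) ⊎ Accept (hi (suc r) 0) p)
    drop-or-flat r p = mk↔ₛ′
      (λ { (acc P [] l i) → ⊥-elim-irr (¬Core-V[] (proj₁ (proj₂ i)))
         ; (acc P (true ∷ V) l i) → inj₁ (acc P V l (drop-hi i))
         ; (acc [] (false ∷ V) () i)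
         ; (acc (true ∷ P) (false ∷ V) l i) → ⊥-elim-irr (¬Edge-true {suc r} {P} {V} (proj₁ i) (proj₂ (proj₂ i)))
         ; (acc (false ∷ P) (false ∷ V) l i) → inj₂ (acc P V (suc-injective l) (proj₁ i , turn (proj₁ (proj₂ i)))) })
      (λ { (inj₁ (acc P V l i)) → acc P (true ∷ V) l (drop-hi⁻ i)
         ; (inj₂ (acc P V l i)) → acc (false ∷ P) (false ∷ V) (cong suc l) (turn-flat⁻ i) })
      (λ { (inj₁ _) → refl ; (inj₂ _) → refl })
      λ { (acc P [] l i) → ⊥-elim-irr (¬Core-V[] (proj₁ (proj₂ i)))
        ; (acc P (true ∷ V) l i) → refl
        ; (acc [] (false ∷ V) () i)
        ; (acc (true ∷ P) (false ∷ V) l i) → ⊥-elim-irr (¬Edge-true {suc r} {P} {V} (proj₁ i) (proj₂ (proj₂ i)))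
        ; (acc (false ∷ P) (false ∷ V) l i) → refl }

    -- Above lead `m`, `Edge` leaves V no choice but to read a maximum. `land` and `sink` are this
    -- single move, with the resulting lead written in two ways.
    sink-to : ∀ x p s → (∀ P V → Inv s P V → Core e 0 (m + x) P V × Edge (m + x) P V) →
              (∀ P V → Core e 0 (m + x) P V × Edge (m + x) P V → Inv s P V) →
              Accept (top x) p ↔ Accept s p
    sink-to x p s f g = mk↔ₛ′
      (λ { (acc P [] l i) → ⊥-elim-irr (¬Core-V[] (proj₁ i))
         ; (acc P (true ∷ V) l i) → acc P V l (g P V (drop (proj₁ i) , Edge-drop {m + x} {P} {V} (proj₂ i)))
         ; (acc P (false ∷ V) l i) → ⊥-elim-irr (¬Edge-above {x} {P} {V} (proj₂ i)) })
      (λ { (acc P V l i) → acc P (true ∷ V) l (drop⁻ (proj₁ (f P V i)) , Edge-drop⁻ {m + x} {P} {V} (proj₂ (f P V i))) })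
      (λ _ → refl)
      λ { (acc P [] l i) → ⊥-elim-irr (¬Core-V[] (proj₁ i))
        ; (acc P (true ∷ V) l i) → refl
        ; (acc P (false ∷ V) l i) → ⊥-elim-irr (¬Edge-above {x} {P} {V} (proj₂ i)) }

    land : ∀ p → Accept (top 0) p ↔ Accept (hi m 0) p
    land p = sink-to 0 p (hi m 0)
      (λ { P V (_ , i) → subst (λ z → Core e 0 z P V × Edge z P V) (sym (+-identityʳ m)) i })
      (λ P V i → +-identityʳ m , subst (λ z → Core e 0 z P V × Edge z P V) (+-identityʳ m) i)

    sink : ∀ x p → Accept (top (suc x)) p ↔ Accept (top x) p
    sink x p = sink-to (suc x) p (top x)
      (λ P V → subst (λ z → Core e 0 z P V × Edge z P V) (sym (+-suc m x)))
      (λ P V → subst (λ z → Core e 0 z P V × Edge z P V) (+-suc m x))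

    xp-[] : ∀ r q → Accept (xp r q) 0 ↔ ⊥
    xp-[] r q = mk↔ₛ′ (λ { (acc [] V l i) → ⊥-elim-irr (¬Core-P[] (proj₂ i)) ; (acc (_ ∷ _) V () i) }) (λ ()) (λ ())
      λ { (acc [] V l i) → ⊥-elim-irr (¬Core-P[] (proj₂ i)) ; (acc (_ ∷ _) V () i) }

    xpt-[] : ∀ x → Accept (xpt x) 0 ↔ ⊥
    xpt-[] x = mk↔ₛ′ (λ { (acc [] V l i) → ⊥-elim-irr (¬Core-P[] i) ; (acc (_ ∷ _) V () i) }) (λ ()) (λ ())
      λ { (acc [] V l i) → ⊥-elim-irr (¬Core-P[] i) ; (acc (_ ∷ _) V () i) }

    climb-or-turn : ∀ r q p → Accept (xp r (suc q)) (suc p) ↔ (Accept (xp (suc r) q) p ⊎ Accept (hi (suc r) (suc q)) p)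
    climb-or-turn r q p = mk↔ₛ′
      (λ { (acc [] V () i)
         ; (acc (true ∷ P) V l i) → inj₁ (acc P V (suc-injective l) (trans (sym (+-suc (suc r) q)) (proj₁ i) , shift (proj₂ i)))
         ; (acc (false ∷ P) V l i) → inj₂ (acc P V (suc-injective l) (proj₁ i , turn (proj₂ i))) })
      (λ { (inj₁ (acc P V l i)) → acc (true ∷ P) V (cong suc l) (trans (+-suc (suc r) q) (proj₁ i) , shift⁻ (proj₂ i))
         ; (inj₂ (acc P V l i)) → acc (false ∷ P) V (cong suc l) (proj₁ i , turn⁻ (proj₁ (proj₂ i)) (proj₂ (proj₂ i))) })
      (λ { (inj₁ _) → refl ; (inj₂ _) → refl })
      λ { (acc [] V () i) ; (acc (true ∷ P) V l i) → refl ; (acc (false ∷ P) V l i) → refl }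

    break-or-turn : ∀ r p → suc r ≡ m → Accept (xp r 0) (suc p) ↔ (Accept (xpt 0) p ⊎ Accept (hi (suc r) 0) p)
    break-or-turn r p refl = mk↔ₛ′
      (λ { (acc [] V () i)
         ; (acc (true ∷ P) V l i) → inj₁ (acc P V (suc-injective l) (climb-top (cong suc (sym (+-identityʳ m))) (proj₂ i)))
         ; (acc (false ∷ P) V l i) → inj₂ (acc P V (suc-injective l) (proj₁ i , turn (proj₂ i))) })
      (λ { (inj₁ (acc P V l c)) → acc (true ∷ P) V (cong suc l) (+-identityʳ m , climb-top⁻ (cong suc (sym (+-identityʳ m))) c)
         ; (inj₂ (acc P V l i)) → acc (false ∷ P) V (cong suc l) (proj₁ i , turn⁻ (proj₁ (proj₂ i)) (proj₂ (proj₂ i))) })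
      (λ { (inj₁ _) → refl ; (inj₂ _) → refl })
      λ { (acc [] V () i) ; (acc (true ∷ P) V l i) → refl ; (acc (false ∷ P) V l i) → refl }

    soar-or-turn : ∀ x p → Accept (xpt x) (suc p) ↔ (Accept (xpt (suc x)) p ⊎ Accept (top x) p)
    soar-or-turn x p = mk↔ₛ′
      (λ { (acc [] V () i)
         ; (acc (true ∷ P) V l c) → inj₁ (acc P V (suc-injective l) (climb-top (cong suc (sym (+-suc m x))) c))
         ; (acc (false ∷ P) V l c) → inj₂ (acc P V (suc-injective l) (turn c)) })
      (λ { (inj₁ (acc P V l c)) → acc (true ∷ P) V (cong suc l) (climb-top⁻ (cong suc (sym (+-suc m x))) c)
         ; (inj₂ (acc P V l i)) → acc (false ∷ P) V (cong suc l) (turn⁻ (proj₁ i) (proj₂ i)) })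
      (λ { (inj₁ _) → refl ; (inj₂ _) → refl })
      λ { (acc [] V () i) ; (acc (true ∷ P) V l i) → refl ; (acc (false ∷ P) V l i) → refl }

    mutual
      -- Moves of V leave `p` unchanged. The recursion still terminates, because such moves lower
      -- the lead, raise the lag towards `e`, or reach a state in which P reads next.
      #lo : ℕ → ℕ → ℕ → ℕ
      #lo zero g zero = 1
      #lo (suc j) g zero = 0
      #lo zero g (suc p) = #loR 0 g p
      #lo (suc j) g (suc p) = #lo j (suc g) p + #loR (suc j) g p

      #loR : ℕ → ℕ → ℕ → ℕ
      #loR j (suc g) p = #lo j (suc g) p + #loR (suc j) g p
      #loR j zero p = #lo j 0 p + #xp 0 m' p

      #hi : ℕ → ℕ → ℕ → ℕ
      #hi zero q p = #lo e 0 p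
      #hi (suc r) (suc q) p = #hi r (suc (suc q)) p + #xp r (suc q) p
      #hi (suc r) zero zero = #hi r 1 zero
      #hi (suc r) zero (suc p) = #hi r 1 (suc p) + #hi (suc r) 0 p

      #xp : ℕ → ℕ → ℕ → ℕ
      #xp r q zero = 0
      #xp r (suc q) (suc p) = #xp (suc r) q p + #hi (suc r) (suc q) p
      #xp r zero (suc p) = #xpt 0 p + #hi (suc r) 0 p

      #top : ℕ → ℕ → ℕ
      #top zero p = #hi m 0 p
      #top (suc x) p = #top x p

      #xpt : ℕ → ℕ → ℕ
      #xpt x zero = 0
      #xpt x (suc p) = #xpt (suc x) p + #top x p

    infixl 4 _by_
    _by_ : ∀ {A B C : Set} → A ↔ B → C ↔ B → A ↔ C
    f by h = ↔-trans f (↔-sym h)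

    infixl 5 _⊞_
    _⊞_ : ∀ {a b} {A B : Set} → Fin a ↔ A → Fin b ↔ B → Fin (a + b) ↔ (A ⊎ B)
    f ⊞ g = ↔-trans +↔⊎ (f ⊎-↔ g)

    mutual
      lo↔ : ∀ j g p → j + g ≡ e → Fin (#lo j g p) ↔ Accept (lo j g) p
      lo↔ zero g zero eq = 1↔⊤ by stop g eq
      lo↔ (suc j) g zero eq = 0↔⊥ by lo-[] j g
      lo↔ zero g (suc p) eq = loR↔ 0 g p eq by rise g p
      lo↔ (suc j) g (suc p) eq = lo↔ j (suc g) p (trans (+-suc j g) eq) ⊞ loR↔ (suc j) g p eq by fill-or-rise j g p

      loR↔ : ∀ j g p → j + g ≡ e → Fin (#loR j g p) ↔ Accept (loR j g) p
      loR↔ j (suc g) p eq = lo↔ j (suc g) p eq ⊞ loR↔ (suc j) g p (trans (sym (+-suc j g)) eq) by meet-or-skip j g p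
      loR↔ j zero p eq with refl ← trans (sym (+-identityʳ j)) eq = lo↔ e 0 p eq ⊞ xp↔ 0 m' p refl by meet-or-enter p

      hi↔ : ∀ r q p → r + q ≡ m → Fin (#hi r q p) ↔ Accept (hi r q) p
      hi↔ zero q p refl = lo↔ e 0 p (+-identityʳ e) by leave p
      hi↔ (suc r) (suc q) p eq = hi↔ r (suc (suc q)) p (trans (+-suc r _) eq) ⊞ xp↔ r (suc q) p eq by drop-or-hook r q p
      hi↔ (suc r) zero zero eq = hi↔ r 1 zero (trans (+-suc r 0) eq) by drop-last r
      hi↔ (suc r) zero (suc p) eq = hi↔ r 1 (suc p) (trans (+-suc r 0) eq) ⊞ hi↔ (suc r) 0 p eq by drop-or-flat r p

      xp↔ : ∀ r q p → suc r + q ≡ m → Fin (#xp r q p) ↔ Accept (xp r q) p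
      xp↔ r q zero eq = 0↔⊥ by xp-[] r q
      xp↔ r (suc q) (suc p) eq = xp↔ (suc r) q p (trans (sym (+-suc (suc r) q)) eq) ⊞ hi↔ (suc r) (suc q) p eq by climb-or-turn r q p
      xp↔ r zero (suc p) eq = xpt↔ 0 p ⊞ hi↔ (suc r) 0 p eq by break-or-turn r p (trans (sym (+-identityʳ (suc r))) eq)

      top↔ : ∀ x p → Fin (#top x p) ↔ Accept (top x) p
      top↔ zero p = hi↔ m 0 p (+-identityʳ m) by land p
      top↔ (suc x) p = top↔ x p by sink x p

      xpt↔ : ∀ x p → Fin (#xpt x p) ↔ Accept (xpt x) p
      xpt↔ x zero = 0↔⊥ by xpt-[] x
      xpt↔ x (suc p) = xpt↔ (suc x) p ⊞ top↔ x p by soar-or-turn x p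

  -- Ranks and selection in binary words

  at : List Bool → ℕ → Bool
  at [] p = false
  at (x ∷ w) zero = x
  at (x ∷ w) (suc p) = at w p

  rank : Bool → List Bool → ℕ → ℕ
  rank b w zero = 0
  rank b [] (suc p) = 0
  rank true (true ∷ w) (suc p) = suc (rank true w p)
  rank true (false ∷ w) (suc p) = rank true w p
  rank false (true ∷ w) (suc p) = rank false w p
  rank false (false ∷ w) (suc p) = suc (rank false w p)

  sel : Bool → List Bool → ℕ → ℕ
  sel b [] i = 0
  sel true (true ∷ w) zero = 0
  sel true (true ∷ w) (suc i) = suc (sel true w i)
  sel true (false ∷ w) i = suc (sel true w i)
  sel false (true ∷ w) i = suc (sel false w i)
  sel false (false ∷ w) zero = 0
  sel false (false ∷ w) (suc i) = suc (sel false w i)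

  sel-< : ∀ b w i → i < cnt b w → sel b w i < length w
  sel-< true (true ∷ w) zero l = s≤s z≤n
  sel-< true (true ∷ w) (suc i) (s≤s l) = s≤s (sel-< true w i l)
  sel-< true (false ∷ w) i l = s≤s (sel-< true w i l)
  sel-< false (true ∷ w) i l = s≤s (sel-< false w i l)
  sel-< false (false ∷ w) zero l = s≤s z≤n
  sel-< false (false ∷ w) (suc i) (s≤s l) = s≤s (sel-< false w i l)

  at-sel : ∀ b w i → i < cnt b w → at w (sel b w i) ≡ b
  at-sel true (true ∷ w) zero l = refl
  at-sel true (true ∷ w) (suc i) (s≤s l) = at-sel true w i l
  at-sel true (false ∷ w) i l = at-sel true w i l
  at-sel false (true ∷ w) i l = at-sel false w i l
  at-sel false (false ∷ w) zero l = refl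
  at-sel false (false ∷ w) (suc i) (s≤s l) = at-sel false w i l

  rank-sel : ∀ b w i → i < cnt b w → rank b w (sel b w i) ≡ i
  rank-sel true (true ∷ w) zero l = refl
  rank-sel true (true ∷ w) (suc i) (s≤s l) = cong suc (rank-sel true w i l)
  rank-sel true (false ∷ w) i l = rank-sel true w i l
  rank-sel false (true ∷ w) i l = rank-sel false w i l
  rank-sel false (false ∷ w) zero l = refl
  rank-sel false (false ∷ w) (suc i) (s≤s l) = cong suc (rank-sel false w i l)

  sel-rank : ∀ b w p → p < length w → at w p ≡ b → sel b w (rank b w p) ≡ p
  sel-rank true (true ∷ w) zero l h = refl
  sel-rank true (true ∷ w) (suc p) (s≤s l) h = cong suc (sel-rank true w p l h)
  sel-rank true (false ∷ w) (suc p) (s≤s l) h = cong suc (sel-rank true w p l h)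
  sel-rank false (true ∷ w) (suc p) (s≤s l) h = cong suc (sel-rank false w p l h)
  sel-rank false (false ∷ w) zero l h = refl
  sel-rank false (false ∷ w) (suc p) (s≤s l) h = cong suc (sel-rank false w p l h)

  rank-< : ∀ b w p → p < length w → at w p ≡ b → rank b w p < cnt b w
  rank-< true (true ∷ w) zero l h = s≤s z≤n
  rank-< true (true ∷ w) (suc p) (s≤s l) h = s≤s (rank-< true w p l h)
  rank-< true (false ∷ w) (suc p) (s≤s l) h = rank-< true w p l h
  rank-< false (true ∷ w) (suc p) (s≤s l) h = rank-< false w p l h
  rank-< false (false ∷ w) zero l h = s≤s z≤n
  rank-< false (false ∷ w) (suc p) (s≤s l) h = s≤s (rank-< false w p l h)

  sel-mono : ∀ b w {i j} → i < j → j < cnt b w → sel b w i < sel b w j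
  sel-mono true (true ∷ w) {zero} {suc j} h l = s≤s z≤n
  sel-mono true (true ∷ w) {suc i} {suc j} (s≤s h) (s≤s l) = s≤s (sel-mono true w h l)
  sel-mono true (false ∷ w) h l = s≤s (sel-mono true w h l)
  sel-mono false (true ∷ w) h l = s≤s (sel-mono false w h l)
  sel-mono false (false ∷ w) {zero} {suc j} h l = s≤s z≤n
  sel-mono false (false ∷ w) {suc i} {suc j} (s≤s h) (s≤s l) = s≤s (sel-mono false w h l)

  sel-cancel-< : ∀ b w {i j} → i < cnt b w → sel b w i < sel b w j → i < j
  sel-cancel-< b w {i} {j} l h with <-cmp i j
  ... | tri< i<j _ _ = i<j
  ... | tri≈ _ refl _ = contradiction h (<-irrefl refl)
  ... | tri> _ _ j<i = contradiction (<-trans h (sel-mono b w j<i l)) (<-irrefl refl)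

  rank-mono : ∀ b w {p q} → p < length w → at w p ≡ b → q < length w → at w q ≡ b →
              p < q → rank b w p < rank b w q
  rank-mono b w pl pb ql qb h = sel-cancel-< b w (rank-< b w _ pl pb)
    (subst₂ _<_ (sym (sel-rank b w _ pl pb)) (sym (sel-rank b w _ ql qb)) h)

  ahead-< : ∀ w {i j} → i < cnt false w → j < ahead w i → sel true w j < sel false w i
  ahead-< (true ∷ w) {i} {zero} l h = s≤s z≤n
  ahead-< (true ∷ w) {i} {suc j} l (s≤s h) = s≤s (ahead-< w l h)
  ahead-< (false ∷ w) {suc i} {j} (s≤s l) h = s≤s (ahead-< w l h)

  ahead-≥ : ∀ w {i j} → i < cnt false w → j < cnt true w → ahead w i ≤ j → sel false w i < sel true w j
  ahead-≥ (true ∷ w) {i} {suc j} l (s≤s k) (s≤s h) = s≤s (ahead-≥ w l k h)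
  ahead-≥ (false ∷ w) {zero} {j} l k h = s≤s z≤n
  ahead-≥ (false ∷ w) {suc i} {j} (s≤s l) k h = s≤s (ahead-≥ w l k h)

  <-ahead : ∀ w {i j} → i < cnt false w → j < cnt true w → sel true w j < sel false w i → j < ahead w i
  <-ahead w {i} {j} l k h with <-≤-connex j (ahead w i)
  ... | inj₁ j<a = j<a
  ... | inj₂ a≤j = contradiction h (<⇒≯ (ahead-≥ w l k a≤j))

  ≥-ahead : ∀ w {i j} → i < cnt false w → j < cnt true w → sel false w i < sel true w j → ahead w i ≤ j
  ≥-ahead w {i} {j} l k h with <-≤-connex j (ahead w i)
  ... | inj₁ j<a = contradiction h (<⇒≯ (ahead-< w l j<a))
  ... | inj₂ a≤j = a≤j

  ahead-≤-cnt : ∀ w i → ahead w i ≤ cnt true w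
  ahead-≤-cnt [] i = z≤n
  ahead-≤-cnt (true ∷ w) i = s≤s (ahead-≤-cnt w i)
  ahead-≤-cnt (false ∷ w) zero = z≤n
  ahead-≤-cnt (false ∷ w) (suc i) = ahead-≤-cnt w i

  ahead-mono : ∀ w {i j} → i ≤ j → j < cnt false w → ahead w i ≤ ahead w j
  ahead-mono (true ∷ w) h l = s≤s (ahead-mono w h l)
  ahead-mono (false ∷ w) {zero} h l = z≤n
  ahead-mono (false ∷ w) {suc i} (s≤s h) (s≤s l) = ahead-mono w h l

  cnt-length : ∀ w → cnt true w + cnt false w ≡ length w
  cnt-length [] = refl
  cnt-length (true ∷ w) = cong suc (cnt-length w)
  cnt-length (false ∷ w) = trans (+-suc (cnt true w) _) (cong suc (cnt-length w))

  at-ext : ∀ w w' → length w ≡ length w' → (∀ p → p < length w → at w p ≡ at w' p) → w ≡ w'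
  at-ext [] [] _ _ = refl
  at-ext (x ∷ w) (x' ∷ w') l h =
    cong₂ _∷_ (h 0 (s≤s z≤n)) (at-ext w w' (suc-injective l) (λ p k → h (suc p) (s≤s k)))

  -- Permutations coded by the words P and V

  module IncreasingEnumerations
    (f g : ℕ → ℕ) (s t : ℕ)
    (f-mono : ∀ {i j} → i < j → j < s → f i < f j)
    (g-mono : ∀ {i j} → i < j → j < t → g i < g j)
    (f⊆g : ∀ i → i < s → ∃[ j ] j < t × f i ≡ g j)
    (g⊆f : ∀ j → j < t → ∃[ i ] i < s × g j ≡ f i) where

    -- Once the first `n` terms agree, the next term of either sequence occurs in the other at an
    -- index at least `n`, because monotonicity excludes the earlier ones. Each next term is then at
    -- least the other.
    agree : ∀ n → (∀ i → i < n → i < s → i < t × f i ≡ g i) × (∀ i → i < n → i < t → i < s × f i ≡ g i)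
    agree zero = (λ _ ()) , (λ _ ())
    agree (suc n) = left , right
      where
      left₀ = proj₁ (agree n)
      right₀ = proj₂ (agree n)
      g≥ : ∀ j → j < t → (∃[ i ] i < n × i < s × f i ≡ g j → ⊥) → n ≤ j
      g≥ j j<t absent with <-≤-connex j n
      ... | inj₁ j<n = ⊥-elim (absent (j , j<n , right₀ j j<n j<t))
      ... | inj₂ n≤j = n≤j
      f≥ : ∀ j → j < s → (∃[ i ] i < n × i < t × g i ≡ f j → ⊥) → n ≤ j
      f≥ j j<s absent with <-≤-connex j n
      ... | inj₁ j<n = ⊥-elim (absent (j , j<n , proj₁ (left₀ j j<n j<s) , sym (proj₂ (left₀ j j<n j<s))))
      ... | inj₂ n≤j = n≤j
      f-inj : ∀ {i} → i < n → n < s → f i ≡ f n → ⊥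
      f-inj i<n n<s eq = <⇒≢ (f-mono i<n n<s) eq
      g-inj : ∀ {i} → i < n → n < t → g i ≡ g n → ⊥
      g-inj i<n n<t eq = <⇒≢ (g-mono i<n n<t) eq
      mono-≤ : ∀ {h : ℕ → ℕ} {u} → (∀ {i j} → i < j → j < u → h i < h j) → ∀ {i j} → i ≤ j → j < u → h i ≤ h j
      mono-≤ m i≤j j<u with m≤n⇒m<n∨m≡n i≤j
      ... | inj₁ i<j = <⇒≤ (m i<j j<u)
      ... | inj₂ refl = ≤-refl
      above : n < s → ∃[ j ] j < t × f n ≡ g j × n ≤ j
      above n<s with f⊆g n n<s
      ... | j , j<t , eq = j , j<t , eq , g≥ j j<t (λ (i , i<n , i<s , e) → f-inj i<n n<s (trans e (sym eq)))
      above′ : n < t → ∃[ j ] j < s × g n ≡ f j × n ≤ j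
      above′ n<t with g⊆f n n<t
      ... | j , j<s , eq = j , j<s , eq , f≥ j j<s (λ (i , i<n , i<t , e) → g-inj i<n n<t (trans e (sym eq)))
      both : n < s → n < t → f n ≡ g n
      both n<s n<t with above n<s | above′ n<t
      ... | j , j<t , eq , n≤j | j' , j'<s , eq' , n≤j' = ≤-antisym
        (≤-trans (mono-≤ f-mono n≤j' j'<s) (≤-reflexive (sym eq')))
        (≤-trans (mono-≤ g-mono n≤j j<t) (≤-reflexive (sym eq)))
      left : ∀ i → i < suc n → i < s → i < t × f i ≡ g i
      left i i<1+n i<s with m≤n⇒m<n∨m≡n (≤-pred i<1+n)
      ... | inj₁ i<n = left₀ i i<n i<s
      ... | inj₂ refl = let (j , j<t , _ , n≤j) = above i<s ; n<t = ≤-<-trans n≤j j<t in n<t , both i<s n<t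
      right : ∀ i → i < suc n → i < t → i < s × f i ≡ g i
      right i i<1+n i<t with m≤n⇒m<n∨m≡n (≤-pred i<1+n)
      ... | inj₁ i<n = right₀ i i<n i<t
      ... | inj₂ refl = let (j , j<s , _ , n≤j) = above′ i<t ; n<s = ≤-<-trans n≤j j<s in n<s , both n<s i<t

    enum-≡ : ∀ i → i < s → f i ≡ g i
    enum-≡ i l = proj₂ (proj₁ (agree (suc i)) i ≤-refl l)

    enum-size : s ≡ t
    enum-size = ≤-antisym (≮⇒≥ (λ t<s → <-irrefl refl (proj₁ (proj₁ (agree (suc t)) t ≤-refl t<s))))
                          (≮⇒≥ (λ s<t → <-irrefl refl (proj₁ (proj₂ (agree (suc s)) s ≤-refl s<t))))

  -- `blocked` and `maximal` identify P as the marking of the left-to-right maxima; `same` and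
  -- `onto` transport it to V. On the remaining entries, `mono` is the avoidance of 321. Functions
  -- on naturals keep `Fin` out of the index arithmetic.
  record Coded (n : ℕ) (A : ℕ → ℕ) (P V : List Bool) : Set where
    field
      lenP    : length P ≡ n
      lenV    : length V ≡ n
      bounded : ∀ {p} → p < n → A p < n
      onto    : ∀ {v} → v < n → ∃[ p ] p < n × A p ≡ v
      same    : ∀ {p} → p < n → at V (A p) ≡ at P p
      mono    : ∀ {p q} → p < q → q < n → at P p ≡ at P q → A p < A q
      blocked : ∀ {p} → p < n → at P p ≡ false → ∃[ q ] q < p × A p < A q
      maximal : ∀ {p q} → q < p → p < n → at P p ≡ true → A q < A p

  module CodedProperties {n A P V} (c : Coded n A P V) where
    open Coded c

    private
      inP : ∀ {p} → p < n → p < length P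
      inP = subst (_ <_) (sym lenP)
      inV : ∀ {p} → p < n → p < length V
      inV = subst (_ <_) (sym lenV)
      outP : ∀ {p} → p < length P → p < n
      outP = subst (_ <_) lenP
      outV : ∀ {v} → v < length V → v < n
      outV = subst (_ <_) lenV

      A-sel-mono : ∀ b {i j} → i < j → j < cnt b P → A (sel b P i) < A (sel b P j)
      A-sel-mono b {i} {j} i<j l = mono (sel-mono b P i<j l) (outP (sel-< b P j l))
        (trans (at-sel b P i (<-trans i<j l)) (sym (at-sel b P j l)))

      A-sel⊆V : ∀ b i → i < cnt b P → ∃[ j ] j < cnt b V × A (sel b P i) ≡ sel b V j
      A-sel⊆V b i l = rank b V v , rank-< b V v (inV (bounded p<n)) b≡ , sym (sel-rank b V v (inV (bounded p<n)) b≡)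
        where
        v = A (sel b P i)
        p<n : sel b P i < n
        p<n = outP (sel-< b P i l)
        b≡ : at V v ≡ b
        b≡ = trans (same p<n) (at-sel b P i l)

      V⊆A-sel : ∀ b j → j < cnt b V → ∃[ i ] i < cnt b P × sel b V j ≡ A (sel b P i)
      V⊆A-sel b j l with onto (outV (sel-< b V j l))
      ... | p , p<n , A≡ = rank b P p , rank-< b P p (inP p<n) b≡
                         , trans (sym A≡) (cong A (sym (sel-rank b P p (inP p<n) b≡)))
        where
        b≡ : at P p ≡ b
        b≡ = trans (sym (same p<n)) (trans (cong (at V) A≡) (at-sel b V j l))

    module Enum (b : Bool) = IncreasingEnumerations (λ i → A (sel b P i)) (sel b V) (cnt b P) (cnt b V)
      (A-sel-mono b) (sel-mono b V) (A-sel⊆V b) (V⊆A-sel b)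

    -- Both sides enumerate, in increasing order, the values marked `b`.
    A-sel : ∀ b i → i < cnt b P → A (sel b P i) ≡ sel b V i
    A-sel b = Enum.enum-≡ b

    cnt-≡ : ∀ b → cnt b P ≡ cnt b V
    cnt-≡ b = Enum.enum-size b

    A-rank : ∀ {b p} → p < n → at P p ≡ b → A p ≡ sel b V (rank b P p)
    A-rank {b} {p} p<n h = trans (cong A (sym (sel-rank b P p (inP p<n) h)))
      (A-sel b (rank b P p) (rank-< b P p (inP p<n) h))

    inversion : ∀ {p q} → p < q → q < n → A q < A p → at P p ≡ true × at P q ≡ false
    inversion {p} {q} p<q q<n h with at P p in ep | at P q in eq
    ... | true | false = refl , refl
    ... | true | true = contradiction (maximal p<q q<n eq) (<⇒≯ h)
    ... | false | true = contradiction (maximal p<q q<n eq) (<⇒≯ h)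
    ... | false | false = contradiction (mono p<q q<n (trans ep (sym eq))) (<⇒≯ h)

    blocker-true : ∀ {p} → p < n → at P p ≡ false → ∃[ q ] q < p × A p < A q × at P q ≡ true
    blocker-true p<n h with blocked p<n h
    ... | q , q<p , l = q , q<p , l , proj₁ (inversion q<p p<n l)

    -- A maximum that exceeds the `i`-th remaining entry from the left has some rank `j`: it is not
    -- among the maxima below the entry, so `ahead V i ≤ j`, and it is among those to its left, so
    -- `j < ahead P i`.
    above : ∀ i → i < cnt false V → ahead V i < ahead P i
    above i l = ≤-<-trans
      (≥-ahead V l (subst (j <_) (cnt-≡ true) j<) (subst₂ _<_ (A-sel false i l′) (A-rank q<n q-true) A<))
      (<-ahead P l′ j< (subst (_< sel false P i) (sym (sel-rank true P q (inP q<n) q-true)) q<p))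
      where
      l′ : i < cnt false P
      l′ = subst (i <_) (sym (cnt-≡ false)) l
      p<n : sel false P i < n
      p<n = outP (sel-< false P i l′)
      blocker : ∃[ q ] q < sel false P i × A (sel false P i) < A q × at P q ≡ true
      blocker = blocker-true p<n (at-sel false P i l′)
      q = proj₁ blocker
      q<p = proj₁ (proj₂ blocker)
      A< = proj₁ (proj₂ (proj₂ blocker))
      q-true = proj₂ (proj₂ (proj₂ blocker))
      q<n : q < n
      q<n = <-trans q<p p<n
      j = rank true P q
      j< : j < cnt true P
      j< = rank-< true P q (inP q<n) q-true

  unique : ∀ {n A P V P' V'} → Coded n A P V → Coded n A P' V' → P ≡ P' × V ≡ V'
  unique {n} {A} {P} {V} {P'} {V'} c c' = P≡ , at-ext V V' (trans C.lenV (sym C'.lenV)) at-V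
    where
    module C = Coded c
    module C' = Coded c'
    at-P : ∀ p → p < n → at P p ≡ at P' p
    at-P p l with at P p in e | at P' p in e'
    ... | true | true = refl
    ... | false | false = refl
    ... | true | false = let (q , q<p , h) = C'.blocked l e' in contradiction (C.maximal q<p l e) (<⇒≯ h)
    ... | false | true = let (q , q<p , h) = C.blocked l e in contradiction (C'.maximal q<p l e') (<⇒≯ h)
    P≡ : P ≡ P'
    P≡ = at-ext P P' (trans C.lenP (sym C'.lenP)) (λ p l → at-P p (subst (p <_) C.lenP l))
    at-V : ∀ v → v < length V → at V v ≡ at V' v
    at-V v l with C.onto (subst (v <_) C.lenV l)
    ... | p , p<n , refl = trans (C.same p<n) (trans (at-P p p<n) (sym (C'.same p<n)))

  -- Reconstruction of the permutation from its words

  value : List Bool → List Bool → ℕ → ℕ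
  value P V p = sel (at P p) V (rank (at P p) P p)

  module Decode {n P V} (lenP : length P ≡ n) (cnt-≡ : ∀ b → cnt b P ≡ cnt b V)
                (above : ∀ i → i < cnt false V → ahead V i < ahead P i) where

    private
      inP : ∀ {p} → p < n → p < length P
      inP = subst (_ <_) (sym lenP)

    lenV : length V ≡ n
    lenV = trans (sym (cnt-length V)) (trans (sym (cong₂ _+_ (cnt-≡ true) (cnt-≡ false))) (trans (cnt-length P) lenP))

    rank-<V : ∀ {b p} → p < n → at P p ≡ b → rank b P p < cnt b V
    rank-<V {b} {p} l h = subst (_ <_) (cnt-≡ b) (rank-< b P p (inP l) h)

    value-at : ∀ {b p} → at P p ≡ b → value P V p ≡ sel b V (rank b P p)
    value-at refl = refl

    value-< : ∀ {p} → p < n → value P V p < n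
    value-< {p} l = subst (_ <_) lenV (sel-< (at P p) V _ (rank-<V l refl))

    value-mono : ∀ {p q} → p < q → q < n → at P p ≡ at P q → value P V p < value P V q
    value-mono {p} {q} p<q q<n h = subst (_< value P V q) (sym (value-at h))
      (sel-mono (at P q) V (rank-mono (at P q) P (inP (<-trans p<q q<n)) h (inP q<n) refl p<q) (rank-<V q<n refl))

    coded : Coded n (value P V) P V
    coded = record
      { lenP = lenP
      ; lenV = lenV
      ; bounded = value-<
      ; onto = λ {v} v<n → let b = at V v
                               v<V = subst (v <_) (sym lenV) v<n
                               i = rank b V v
                               i<V = rank-< b V v v<V refl
                               i<P = subst (i <_) (sym (cnt-≡ b)) i<V in
          sel b P i , subst (_ <_) lenP (sel-< b P i i<P)
          , trans (value-at (at-sel b P i i<P)) (trans (cong (sel b V) (rank-sel b P i i<P)) (sel-rank b V v v<V refl))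
      ; same = λ {p} l → at-sel (at P p) V _ (rank-<V l refl)
      ; mono = value-mono
      ; blocked = blocked′
      ; maximal = record′
      }
      where
      blocked′ : ∀ {p} → p < n → at P p ≡ false → ∃[ q ] q < p × value P V p < value P V q
      blocked′ {p} l h = q , q<p , subst₂ _<_ (sym (value-at h)) (sym (trans (value-at qt) (cong (sel true V) (rank-sel true P j j<P))))
          (ahead-≥ V i<V (subst (j <_) (cnt-≡ true) j<P) ≤-refl)
        where
        i = rank false P p
        i<V = rank-<V l h
        -- The least maximum above the value of the entry; the hypothesis `above` places it to the
        -- left.
        j = ahead V i
        j<P : j < cnt true P
        j<P = ≤-trans (above i i<V) (ahead-≤-cnt P i)
        q = sel true P j
        qt = at-sel true P j j<P
        q<p : q < p
        q<p = subst (q <_) (sel-rank false P p (inP l) h) (ahead-< P (subst (i <_) (sym (cnt-≡ false)) i<V) (above i i<V))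
      record′ : ∀ {p q} → q < p → p < n → at P p ≡ true → value P V q < value P V p
      record′ {p} {q} q<p p<n h with at P q in eq
      ... | true = subst (_< value P V p) (value-at eq) (value-mono q<p p<n (trans eq (sym h)))
      ... | false = subst (sel false V i <_) (sym (value-at h)) (ahead-≥ V i<V (rank-<V p<n h) b≤j)
        where
        q<n = <-trans q<p p<n
        i = rank false P q
        i<V = rank-<V q<n eq
        j = rank true P p
        b≤j : ahead V i ≤ j
        -- The maxima to the left of `q` are also to the left of `p`, and by `above` they outnumber
        -- those below the entry at `q`.
        b≤j = ≤-trans (<⇒≤ (above i i<V)) (≥-ahead P (subst (i <_) (sym (cnt-≡ false)) i<V) (rank-< true P p (inP p<n) h)
          (subst₂ _<_ (sym (sel-rank false P q (inP q<n) eq)) (sym (sel-rank true P p (inP p<n) h)) q<p))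

  -- Pattern occurrences over natural-number indices

  oneLine : ∀ {m n} → Vec (Fin m) n → ℕ → ℕ
  oneLine [] p = 0
  oneLine (x ∷ xs) zero = toℕ x
  oneLine (x ∷ xs) (suc p) = oneLine xs p

  oneLine-lookup : ∀ {m n} (α : Vec (Fin m) n) i → oneLine α (toℕ i) ≡ toℕ (lookup α i)
  oneLine-lookup (x ∷ xs) Fin.zero = refl
  oneLine-lookup (x ∷ xs) (Fin.suc i) = oneLine-lookup xs i

  nth : List ℕ → ℕ → ℕ
  nth [] a = 0
  nth (x ∷ xs) zero = x
  nth (x ∷ xs) (suc a) = nth xs a

  nth-lookup : ∀ xs i → nth xs (toℕ i) ≡ List.lookup xs i
  nth-lookup (x ∷ xs) Fin.zero = refl
  nth-lookup (x ∷ xs) (Fin.suc i) = nth-lookup xs i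

  nth-map : ∀ (f : ℕ → ℕ) xs a → a < length xs → nth (map f xs) a ≡ f (nth xs a)
  nth-map f (x ∷ xs) zero l = refl
  nth-map f (x ∷ xs) (suc a) (s≤s l) = nth-map f xs a l

  nth-All : ∀ {Q : ℕ → Set} {xs} → All Q xs → ∀ a → a < length xs → Q (nth xs a)
  nth-All (h ∷ hs) zero l = h
  nth-All (h ∷ hs) (suc a) (s≤s l) = nth-All hs a l

  nth-Linked : ∀ {xs} → Linked _<_ xs → ∀ {a b} → a < b → b < length xs → nth xs a < nth xs b
  nth-Linked (h ∷ hs) {zero} {suc zero} _ l = h
  nth-Linked (h ∷ hs) {zero} {suc (suc b)} _ (s≤s l) = <-trans h (nth-Linked hs {0} {suc b} (s≤s z≤n) l)
  nth-Linked (h ∷ hs) {suc a} {suc b} (s≤s a<b) (s≤s l) = nth-Linked hs a<b l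
  nth-Linked [-] {zero} {suc b} _ (s≤s ())
  nth-Linked [-] {suc a} {suc b} _ (s≤s ())

  seg : (ℕ → ℕ) → ℕ → List ℕ → List ℕ
  seg f n xs = applyUpTo f n ++ xs

  seg-map-upTo : ∀ f n xs → map f (upTo n) ++ xs ≡ seg f n xs
  seg-map-upTo f n xs = cong (_++ xs) (Listₚ.map-upTo f n)

  length-seg : ∀ f n xs → length (seg f n xs) ≡ n + length xs
  length-seg f n xs = trans (Listₚ.length-++ (applyUpTo f n)) (cong (_+ length xs) (Listₚ.length-applyUpTo f n))

  nth-seg-< : ∀ f n xs {a} → a < n → nth (seg f n xs) a ≡ f a
  nth-seg-< f (suc n) xs {zero} l = refl
  nth-seg-< f (suc n) xs {suc a} (s≤s l) = nth-seg-< (λ i → f (suc i)) n xs l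

  nth-seg-+ : ∀ f n xs a → nth (seg f n xs) (n + a) ≡ nth xs a
  nth-seg-+ f zero xs a = refl
  nth-seg-+ f (suc n) xs a = nth-seg-+ (λ i → f (suc i)) n xs a

  map-seg : ∀ (h f : ℕ → ℕ) n xs → map h (seg f n xs) ≡ seg (λ i → h (f i)) n (map h xs)
  map-seg h f n xs = trans (Listₚ.map-++ h (applyUpTo f n) xs) (cong (_++ map h xs) (Listₚ.map-applyUpTo f h n))

  seg-cong : ∀ {f g} n {xs ys} → (∀ i → i < n → f i ≡ g i) → xs ≡ ys → seg f n xs ≡ seg g n ys
  seg-cong zero h e = e
  seg-cong (suc n) h e = cong₂ _∷_ (h 0 (s≤s z≤n)) (seg-cong n (λ i l → h (suc i) (s≤s l)) e)

  All-seg : ∀ {Q : ℕ → Set} f n {xs} → (∀ i → i < n → Q (f i)) → All Q xs → All Q (seg f n xs)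
  All-seg f zero h hs = hs
  All-seg f (suc n) h hs = h 0 (s≤s z≤n) ∷ All-seg (λ i → f (suc i)) n (λ i l → h (suc i) (s≤s l)) hs

  Linked-seg : ∀ f n {x xs} → (∀ i → suc i < n → f i < f (suc i)) → (∀ i → suc i ≡ n → f i < x) →
               Linked _<_ (x ∷ xs) → Linked _<_ (seg f n (x ∷ xs))
  Linked-seg f zero h e hs = hs
  Linked-seg f (suc zero) h e hs = e 0 refl ∷ hs
  Linked-seg f (suc (suc n)) h e hs = h 0 (s≤s (s≤s z≤n)) ∷
    Linked-seg (λ i → f (suc i)) (suc n) (λ i l → h (suc i) (s≤s l)) (λ i l → e (suc i) (cong suc l)) hs

  Linked-seg-[] : ∀ f n → (∀ i → suc i < n → f i < f (suc i)) → Linked _<_ (seg f n [])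
  Linked-seg-[] f zero h = []
  Linked-seg-[] f (suc zero) h = [-]
  Linked-seg-[] f (suc (suc n)) h = h 0 (s≤s (s≤s z≤n)) ∷
    Linked-seg-[] (λ i → f (suc i)) (suc n) (λ i l → h (suc i) (s≤s l))

  record Occurrence (n : ℕ) (A : ℕ → ℕ) (τ : List ℕ) : Set where
    field
      index  : ℕ → ℕ
      index< : ∀ {a} → a < length τ → index a < n
      mono   : ∀ {a b} → a < b → b < length τ → index a < index b
      order  : ∀ {a b} → a < length τ → b < length τ → (A (index a) < A (index b)) ⇔ (nth τ a < nth τ b)

  Contains⇒Occurrence : ∀ {n} (α : Vec (Fin n) n) τ → Contains α τ → Occurrence n (oneLine α) τ
  Contains⇒Occurrence {n} α τ (ι , ι-mono , ι-order) = record
    { index = index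
    ; index< = λ {a} l → subst (_< n) (sym (index-ι l)) (toℕ<n _)
    ; mono = λ {a} {b} a<b l → subst₂ _<_ (sym (index-ι (<-trans a<b l))) (sym (index-ι l))
        (ι-mono _ _ (subst₂ _<_ (sym (toℕ-fromℕ< (<-trans a<b l))) (sym (toℕ-fromℕ< l)) a<b))
    ; order = λ {a} {b} la lb →
        subst₂ _⇔_ (cong₂ _<_ (A-index la) (A-index lb)) (cong₂ _<_ (τ-index la) (τ-index lb))
          (ι-order (fromℕ< la) (fromℕ< lb))
    }
    where
    index : ℕ → ℕ
    index a with a <? length τ
    ... | yes l = toℕ (ι (fromℕ< l))
    ... | no _ = 0
    index-ι : ∀ {a} (l : a < length τ) → index a ≡ toℕ (ι (fromℕ< l))
    index-ι {a} l with a <? length τ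
    ... | yes _ = refl
    ... | no nl = contradiction l nl
    A-index : ∀ {a} (l : a < length τ) → toℕ (lookup α (ι (fromℕ< l))) ≡ oneLine α (index a)
    A-index l = trans (sym (oneLine-lookup α _)) (cong (oneLine α) (sym (index-ι l)))
    τ-index : ∀ {a} (l : a < length τ) → List.lookup τ (fromℕ< l) ≡ nth τ a
    τ-index l = trans (sym (nth-lookup τ _)) (cong (nth τ) (toℕ-fromℕ< l))

  -- qs lists the positions of an occurrence of τ and gs its values in increasing order; the letters of τ
  -- count from 1, whence pred.
  contains : ∀ {n} (α : Vec (Fin n) n) τ (qs gs : List ℕ) →
    Linked _<_ qs → All (_< n) qs → Linked _<_ gs → All (λ v → 1 ≤ v × v ≤ length gs) τ →
    map (oneLine α) qs ≡ map (λ v → nth gs (pred v)) τ → Contains α τ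
  contains {n} α τ qs gs qs↑ qs< gs↑ τ-range eq = ι , ι-mono , ι-order
    where
    len : length τ ≡ length qs
    len = trans (sym (Listₚ.length-map (λ v → nth gs (pred v)) τ))
            (trans (cong length (sym eq)) (Listₚ.length-map (oneLine α) qs))
    in-qs : ∀ (a : Fin (length τ)) → toℕ a < length qs
    in-qs a = subst (toℕ a <_) len (toℕ<n a)
    ι : Fin (length τ) → Fin n
    ι a = fromℕ< (nth-All qs< (toℕ a) (in-qs a))
    ι-nth : ∀ a → toℕ (ι a) ≡ nth qs (toℕ a)
    ι-nth a = toℕ-fromℕ< _
    ι-mono : ∀ a b → toℕ a < toℕ b → toℕ (ι a) < toℕ (ι b)
    ι-mono a b l = subst₂ _<_ (sym (ι-nth a)) (sym (ι-nth b)) (nth-Linked qs↑ l (in-qs b))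
    g : ℕ → ℕ
    g v = nth gs (pred v)
    value-g : ∀ a → toℕ (lookup α (ι a)) ≡ g (List.lookup τ a)
    value-g a = begin
      toℕ (lookup α (ι a))            ≡⟨ oneLine-lookup α (ι a) ⟨
      oneLine α (toℕ (ι a))           ≡⟨ cong (oneLine α) (ι-nth a) ⟩
      oneLine α (nth qs (toℕ a))      ≡⟨ nth-map (oneLine α) qs (toℕ a) (in-qs a) ⟨
      nth (map (oneLine α) qs) (toℕ a) ≡⟨ cong (λ l → nth l (toℕ a)) eq ⟩
      nth (map g τ) (toℕ a)           ≡⟨ nth-map g τ (toℕ a) (toℕ<n a) ⟩
      g (nth τ (toℕ a))               ≡⟨ cong g (nth-lookup τ a) ⟩
      g (List.lookup τ a) ∎
      where open ≡-Reasoning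
    range : ∀ a → 1 ≤ List.lookup τ a × List.lookup τ a ≤ length gs
    range a = subst (λ v → 1 ≤ v × v ≤ length gs) (nth-lookup τ a) (nth-All τ-range (toℕ a) (toℕ<n a))
    g-mono : ∀ {v w} → 1 ≤ v → w ≤ length gs → v < w → g v < g w
    g-mono {suc v} {suc w} _ l (s≤s h) = nth-Linked gs↑ h l
    ι-order : ∀ a b → (toℕ (lookup α (ι a)) < toℕ (lookup α (ι b))) ⇔ (List.lookup τ a < List.lookup τ b)
    ι-order a b = mk⇔ to (λ h → subst₂ _<_ (sym (value-g a)) (sym (value-g b)) (g-mono (proj₁ (range a)) (proj₂ (range b)) h))
      where
      to : toℕ (lookup α (ι a)) < toℕ (lookup α (ι b)) → List.lookup τ a < List.lookup τ b
      to h with <-cmp (List.lookup τ a) (List.lookup τ b)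
      ... | tri< l _ _ = l
      ... | tri≈ _ e _ = contradiction (trans (value-g a) (trans (cong g e) (sym (value-g b)))) (<⇒≢ h)
      ... | tri> _ _ l = contradiction (subst₂ _<_ (value-g a) (value-g b) h) (<⇒≯ (g-mono (proj₁ (range b)) (proj₂ (range a)) l))

  gap : ∀ {f : ℕ → ℕ} {k} → (∀ x → x < k → f x < f (suc x)) → ∀ x d → x + d ≤ k → f x + d ≤ f (x + d)
  gap {f} h x zero l = ≤-reflexive (trans (+-identityʳ (f x)) (cong f (sym (+-identityʳ x))))
  gap {f} {k} h x (suc d) l = subst₂ _≤_ (sym (+-suc (f x) d)) (cong f (sym (+-suc x d)))
    (≤-<-trans (gap {f} h x d (<⇒≤ x+d<k)) (h (x + d) x+d<k))
    where
    x+d<k : x + d < k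
    x+d<k = subst (_≤ k) (+-suc x d) l

  gap-≤ : ∀ {f : ℕ → ℕ} {k} → (∀ x → x < k → f x < f (suc x)) → ∀ {x y} → x ≤ y → y ≤ k → f x ≤ f y
  gap-≤ {f} h {x} {y} x≤y y≤k with d , refl ← m≤n⇒∃[o]m+o≡n x≤y = ≤-trans (m≤m+n (f x) d) (gap {f} h x d y≤k)

  -- Long patterns versus steep pairs of remaining entries

  module Forward (e m' : ℕ) {n A P V} (c : Coded n A P V) where
    open Machine e m'
    open Coded c
    open CodedProperties c

    -- The hypotheses are what the two long patterns share. Replacing the lower entries by
    -- consecutive remaining ones with the same last entry can only move the earlier ones to the
    -- right, which keeps the maxima before them. As the last lower entry lies below `u 0`, the
    -- number of maxima below it is at most the rank of `u 0`.
    steep : (u l : ℕ → ℕ) →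
      (∀ x → x < m → u x < u (suc x)) → (∀ y → y < suc e → l y < l (suc y)) →
      u m' < l 0 → u m < l 1 → l (suc e) < n →
      (∀ x y → x ≤ m → y ≤ suc e → A (l y) < A (u x)) →
      ∃[ i ] suc e + i < cnt false V × Steep 0 (ahead V (suc e + i)) (ahead P i) (ahead P (suc i))
    steep u l u↑ l↑ u<l₀ u<l₁ l<n A< = i , i<V , p₁ , p₂
      where
      l-le : ∀ {y} → y ≤ suc e → l y < n
      l-le y≤ = ≤-<-trans (gap-≤ {l} l↑ y≤ ≤-refl) l<n
      u<l1 : ∀ {x} → x ≤ m → u x < l 1
      u<l1 x≤ = ≤-<-trans (gap-≤ {u} u↑ x≤ ≤-refl) u<l₁
      u0<l : ∀ {y} → y ≤ suc e → u 0 < l y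
      u0<l y≤ = ≤-<-trans (gap-≤ {u} u↑ z≤n (n≤1+n m')) (<-≤-trans u<l₀ (gap-≤ {l} l↑ z≤n y≤))
      u<n : ∀ {x} → x ≤ m → u x < n
      u<n x≤ = <-trans (u<l1 x≤) (l-le (s≤s z≤n))
      u-true : ∀ {x} → x ≤ m → at P (u x) ≡ true
      u-true x≤ = proj₁ (inversion (u<l1 x≤) (l-le (s≤s z≤n)) (A< _ 1 x≤ (s≤s z≤n)))
      l-false : ∀ {y} → y ≤ suc e → at P (l y) ≡ false
      l-false y≤ = proj₂ (inversion (u0<l y≤) (l-le y≤) (A< 0 _ z≤n y≤))
      inP : ∀ {p} → p < n → p < length P
      inP = subst (_ <_) (sym lenP)
      U L : ℕ → ℕ
      U x = rank true P (u x)
      L y = rank false P (l y)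
      U↑ : ∀ x → x < m → U x < U (suc x)
      U↑ x x<m = rank-mono true P (inP (u<n (<⇒≤ x<m))) (u-true (<⇒≤ x<m)) (inP (u<n x<m)) (u-true x<m) (u↑ x x<m)
      L↑ : ∀ y → y < suc e → L y < L (suc y)
      L↑ y y< = rank-mono false P (inP (l-le (<⇒≤ y<))) (l-false (<⇒≤ y<)) (inP (l-le y<)) (l-false y<) (l↑ y y<)
      U<cnt : ∀ {x} → x ≤ m → U x < cnt true P
      U<cnt x≤ = rank-< true P _ (inP (u<n x≤)) (u-true x≤)
      L<cnt : ∀ {y} → y ≤ suc e → L y < cnt false P
      L<cnt y≤ = rank-< false P _ (inP (l-le y≤)) (l-false y≤)
      before : ∀ {x y} → x ≤ m → y ≤ suc e → u x < l y → U x < ahead P (L y)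
      before x≤ y≤ h = <-ahead P (L<cnt y≤) (U<cnt x≤)
        (subst₂ _<_ (sym (sel-rank true P _ (inP (u<n x≤)) (u-true x≤)))
                    (sym (sel-rank false P _ (inP (l-le y≤)) (l-false y≤))) h)
      L0≤ : L 0 + suc e ≤ L (suc e)
      L0≤ = gap {L} L↑ 0 (suc e) ≤-refl
      L1≤ : L 1 + e ≤ L (suc e)
      L1≤ = gap {L} L↑ 1 e ≤-refl
      -- The rank at which the run of e + 2 consecutive remaining entries ending in the last lower
      -- entry begins.
      i = L (suc e) ∸ suc e
      e+i : suc e + i ≡ L (suc e)
      e+i = m+[n∸m]≡n (≤-trans (m≤n+m (suc e) (L 0)) L0≤)
      L0≤i : L 0 ≤ i
      L0≤i = subst (_≤ i) (m+n∸n≡m (L 0) (suc e)) (∸-monoˡ-≤ (suc e) L0≤)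
      L1≤i : L 1 ≤ suc i
      L1≤i = +-cancelʳ-≤ e (L 1) (suc i) (≤-trans L1≤ (≤-reflexive (trans (sym e+i) (cong suc (+-comm e i)))))
      top<P : suc e + i < cnt false P
      top<P = subst (_< cnt false P) (sym e+i) (L<cnt ≤-refl)
      i<V : suc e + i < cnt false V
      i<V = subst (suc e + i <_) (cnt-≡ false) top<P
      suci<P : suc i < cnt false P
      suci<P = ≤-<-trans (s≤s (m≤n+m i e)) top<P
      b≤U0 : ahead V (suc e + i) ≤ U 0
      b≤U0 = ≥-ahead V i<V (subst (U 0 <_) (cnt-≡ true) (U<cnt z≤n))
        (subst₂ _<_ (trans (A-rank (l-le ≤-refl) (l-false ≤-refl)) (cong (sel false V) (sym e+i)))
                    (A-rank (u<n z≤n) (u-true z≤n)) (A< 0 (suc e) z≤n ≤-refl))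
      p₁ : ahead V (suc e + i) + m ≤ ahead P i
      p₁ = begin
        ahead V (suc e + i) + suc m'   ≤⟨ +-monoˡ-≤ m b≤U0 ⟩
        U 0 + suc m'                   ≡⟨ +-suc (U 0) m' ⟩
        suc (U 0 + m')                 ≤⟨ s≤s (gap {U} U↑ 0 m' (n≤1+n m')) ⟩
        suc (U m')                     ≤⟨ before (n≤1+n m') z≤n u<l₀ ⟩
        ahead P (L 0)                  ≤⟨ ahead-mono P L0≤i (<-trans (n<1+n i) suci<P) ⟩
        ahead P i ∎
        where open ≤-Reasoning
      p₂ : ahead V (suc e + i) + m < ahead P (suc i)
      p₂ = begin-strict
        ahead V (suc e + i) + m        ≤⟨ +-monoˡ-≤ m b≤U0 ⟩
        U 0 + m                        ≤⟨ gap {U} U↑ 0 m ≤-refl ⟩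
        U m                            <⟨ before ≤-refl (s≤s z≤n) u<l₁ ⟩
        ahead P (L 1)                  ≤⟨ ahead-mono P L1≤i suci<P ⟩
        ahead P (suc i) ∎
        where open ≤-Reasoning

  -- The upper entries of patA stand at all the positions but m among the first m + 2.
  skip-at : ℕ → ℕ → ℕ
  skip-at zero x = suc x
  skip-at (suc m) zero = zero
  skip-at (suc m) (suc x) = suc (skip-at m x)

  skip-at-< : ∀ m {x} → x < m → skip-at m x ≡ x
  skip-at-< (suc m) {zero} _ = refl
  skip-at-< (suc m) {suc x} (s≤s l) = cong suc (skip-at-< m l)

  skip-at-≡ : ∀ m → skip-at m m ≡ suc m
  skip-at-≡ zero = refl
  skip-at-≡ (suc m) = cong suc (skip-at-≡ m)

  skip-at-mono : ∀ m x → skip-at m x < skip-at m (suc x)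
  skip-at-mono zero x = ≤-refl
  skip-at-mono (suc m) zero = s≤s z≤n
  skip-at-mono (suc m) (suc x) = s≤s (skip-at-mono m x)

  module Patterns (e m' : ℕ) where
    open Machine e m' hiding (skip)

    k d : ℕ
    k = 4 + (e + m')
    d = 2 + e

    segA segB : List ℕ
    segA = seg (suc d +_) m (1 ∷ k ∷ seg (2 +_) (suc e) [])
    segB = seg (suc d +_) m (k ∷ seg suc d [])

    block-length : k ∸ 1 ∸ d ≡ m
    block-length = trans (cong (_∸ e) (sym (+-suc e m'))) (m+n∸m≡n e m)

    block-seg : ∀ xs → block k d ++ xs ≡ seg (suc d +_) m xs
    block-seg xs = trans (cong (λ z → map (suc d +_) (upTo z) ++ xs) block-length) (seg-map-upTo (suc d +_) m xs)

    map-seg-[] : ∀ f n → map f (upTo n) ≡ seg f n []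
    map-seg-[] f n = trans (sym (Listₚ.++-identityʳ _)) (seg-map-upTo f n [])

    patA-seg : patA k d ≡ segA
    patA-seg = trans (block-seg _) (cong (λ z → seg (suc d +_) m (1 ∷ k ∷ z)) (map-seg-[] (2 +_) (suc e)))

    patB-seg : patB k d ≡ segB
    patB-seg = trans (block-seg _) (cong (λ z → seg (suc d +_) m (k ∷ z)) (map-seg-[] suc d))

    nthA-hi : ∀ {x} → x < m → nth segA x ≡ suc d + x
    nthA-hi = nth-seg-< (suc d +_) m _

    nthA-1 : nth segA m ≡ 1
    nthA-1 = trans (cong (nth segA) (sym (+-identityʳ m))) (nth-seg-+ (suc d +_) m _ 0)

    nthA-k : nth segA (suc m) ≡ k
    nthA-k = trans (cong (nth segA) (sym (+-comm m 1))) (nth-seg-+ (suc d +_) m _ 1)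

    nthA-lo : ∀ {y} → y < suc e → nth segA (suc (suc m) + y) ≡ 2 + y
    nthA-lo {y} l = trans (cong (nth segA) (trans (cong suc (sym (+-suc m y))) (sym (+-suc m (suc y)))))
      (trans (nth-seg-+ (suc d +_) m _ (2 + y)) (nth-seg-< (2 +_) (suc e) [] l))

    nthB-hi : ∀ {x} → x < m → nth segB x ≡ suc d + x
    nthB-hi = nth-seg-< (suc d +_) m _

    nthB-k : nth segB m ≡ k
    nthB-k = trans (cong (nth segB) (sym (+-identityʳ m))) (nth-seg-+ (suc d +_) m _ 0)

    nthB-lo : ∀ {y} → y < d → nth segB (suc m + y) ≡ suc y
    nthB-lo {y} l = trans (cong (nth segB) (sym (+-suc m y)))
      (trans (nth-seg-+ (suc d +_) m _ (1 + y)) (nth-seg-< suc d [] l))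

    lenA : length segA ≡ m + (3 + e)
    lenA = trans (length-seg (suc d +_) m _) (cong (λ z → m + (2 + z)) (trans (length-seg (2 +_) (suc e) []) (+-identityʳ (suc e))))

    lenB : length segB ≡ m + (3 + e)
    lenB = trans (length-seg (suc d +_) m _) (cong (λ z → m + (1 + z)) (trans (length-seg suc d []) (+-identityʳ d)))

    d<k : d < k
    d<k = s≤s (s≤s (s≤s (m≤n⇒m≤1+n (m≤m+n e m'))))

    module _ {n A P V} (c : Coded n A P V) where
      open Forward e m' c

      -- Here the letter 1 precedes k, so only `m` upper entries stand before the first lower one;
      -- this is why `steep` asks no more than `u m' < l 0`.
      steepA : Occurrence n A segA →
        ∃[ i ] suc e + i < cnt false V × Steep 0 (ahead V (suc e + i)) (ahead P i) (ahead P (suc i))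
      steepA o = steep u l
          (λ x x<m → mono (skip-at-mono m x) (in-τ (skip-at-≤ x<m)))
          l↑
          (mono (≤-reflexive (cong suc (skip-at-< m ≤-refl))) (in-τ (m≤m+n m (2 + e))))
          (subst (λ z → index z < l 1) (sym (skip-at-≡ m)) (mono (s≤s (m≤m+n (suc m) 0)) (in-τ (lo≤ z≤n))))
          (index< (in-τ (lo≤ ≤-refl)))
          (λ x y x≤ y≤ → Equivalence.from (order (in-l y≤) (in-τ (skip-at-≤ x≤)))
            (≤-trans (s≤s (l-val y≤)) (u-val x≤)))
        where
        open Occurrence o
        idx : ℕ → ℕ
        idx zero = m
        idx (suc y) = suc (suc m) + y
        u l : ℕ → ℕ
        u x = index (skip-at m x)
        l y = index (idx y)
        in-τ : ∀ {a} → a ≤ m + (2 + e) → a < length segA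
        in-τ {a} h = subst (suc a ≤_) (sym lenA) (≤-trans (s≤s h) (≤-reflexive (sym (+-suc m (2 + e)))))
        skip-at-≤ : ∀ {x} → x ≤ m → skip-at m x ≤ m + (2 + e)
        skip-at-≤ {x} x≤ = ≤-trans (go m x x≤) (≤-trans (≤-reflexive (+-comm 1 m)) (+-monoʳ-≤ m (s≤s z≤n)))
          where
          go : ∀ m x → x ≤ m → skip-at m x ≤ suc m
          go zero zero _ = ≤-refl
          go (suc m) zero _ = z≤n
          go (suc m) (suc x) (s≤s h) = s≤s (go m x h)
        lo≤ : ∀ {y} → y ≤ e → suc (suc m) + y ≤ m + (2 + e)
        lo≤ {y} h = ≤-trans (≤-reflexive (trans (cong suc (sym (+-suc m y))) (sym (+-suc m (suc y))))) (+-monoʳ-≤ m (s≤s (s≤s h)))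
        l↑ : ∀ y → y < suc e → l y < l (suc y)
        l↑ zero _ = mono (s≤s (≤-trans (n≤1+n m) (m≤m+n (suc m) 0))) (in-τ (lo≤ z≤n))
        l↑ (suc y) (s≤s h) = mono (+-monoʳ-< (suc (suc m)) ≤-refl) (in-τ (lo≤ h))
        in-l : ∀ {y} → y ≤ suc e → idx y < length segA
        in-l {zero} _ = in-τ (m≤m+n m (2 + e))
        in-l {suc y} (s≤s h) = in-τ (lo≤ h)
        l-val : ∀ {y} → y ≤ suc e → nth segA (idx y) ≤ d
        l-val {zero} _ = ≤-trans (≤-reflexive nthA-1) (s≤s z≤n)
        l-val {suc y} (s≤s h) = ≤-trans (≤-reflexive (nthA-lo (s≤s h))) (s≤s (s≤s h))
        u-val : ∀ {x} → x ≤ m → d < nth segA (skip-at m x)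
        u-val x≤ with m≤n⇒m<n∨m≡n x≤
        ... | inj₁ x< = subst (d <_) (sym (trans (cong (nth segA) (skip-at-< m x<)) (nthA-hi x<))) (s≤s (m≤m+n d _))
        ... | inj₂ refl = subst (d <_) (sym (trans (cong (nth segA) (skip-at-≡ m)) nthA-k)) d<k

      steepB : Occurrence n A segB →
        ∃[ i ] suc e + i < cnt false V × Steep 0 (ahead V (suc e + i)) (ahead P i) (ahead P (suc i))
      steepB o = steep index l
          (λ x x<m → mono ≤-refl (in-τ (≤-trans x<m (m≤m+n m (2 + e)))))
          (λ y h → mono (+-monoʳ-< (suc m) ≤-refl) (in-τ (lo≤ h)))
          (mono (s≤s (≤-trans (n≤1+n m') (m≤m+n m 0))) (in-τ (lo≤ z≤n)))
          (mono (s≤s (m≤m+n m 1)) (in-τ (lo≤ (s≤s z≤n))))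
          (index< (in-τ (lo≤ ≤-refl)))
          (λ x y x≤ y≤ → Equivalence.from (order (in-τ (lo≤ y≤)) (in-τ (≤-trans x≤ (m≤m+n m (2 + e)))))
            (≤-trans (s≤s (≤-trans (≤-reflexive (nthB-lo (s≤s y≤))) (s≤s y≤))) (u-val x≤)))
        where
        open Occurrence o
        l : ℕ → ℕ
        l y = index (suc m + y)
        in-τ : ∀ {a} → a ≤ m + (2 + e) → a < length segB
        in-τ {a} h = subst (suc a ≤_) (sym lenB) (≤-trans (s≤s h) (≤-reflexive (sym (+-suc m (2 + e)))))
        lo≤ : ∀ {y} → y ≤ suc e → suc m + y ≤ m + (2 + e)
        lo≤ {y} h = ≤-trans (≤-reflexive (sym (+-suc m y))) (+-monoʳ-≤ m (s≤s h))
        u-val : ∀ {x} → x ≤ m → d < nth segB x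
        u-val x≤ with m≤n⇒m<n∨m≡n x≤
        ... | inj₁ x< = subst (d <_) (sym (nthB-hi x<)) (s≤s (m≤m+n d _))
        ... | inj₂ refl = subst (d <_) (sym nthB-k) d<k

    module _ {n} (α : Vec (Fin n) n) {P V} (c : Coded n (oneLine α) P V)
             (i : ℕ) (i< : suc e + i < cnt false V)
             (steep₁ : ahead V (suc e + i) + m ≤ ahead P i)
             (steep₂ : ahead V (suc e + i) + m < ahead P (suc i)) where
      open Coded c
      open CodedProperties c

      private
        -- The rank of the least maximum above remaining entry i + e + 1. The maxima j, ..., j + m
        -- serve as upper entries and the remaining entries i, ..., i + e + 1 as lower ones.
        j : ℕ
        j = ahead V (suc e + i)
        posT posF valT valF : ℕ → ℕ
        posT x = sel true P (j + x)
        posF y = sel false P (i + y)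
        valT x = sel true V (j + x)
        valF y = sel false V (i + y)

        T< : ∀ {x} → x ≤ m → j + x < cnt true P
        T< x≤ = <-≤-trans (≤-<-trans (+-monoʳ-≤ j x≤) steep₂) (ahead-≤-cnt P (suc i))
        F< : ∀ {y} → y ≤ suc e → i + y < cnt false P
        F< y≤ = subst (_ <_) (sym (cnt-≡ false)) (≤-<-trans (≤-trans (+-monoʳ-≤ i y≤) (≤-reflexive (+-comm i (suc e)))) i<)
        TV< : ∀ {x} → x ≤ m → j + x < cnt true V
        TV< x≤ = subst (_ <_) (cnt-≡ true) (T< x≤)
        FV< : ∀ {y} → y ≤ suc e → i + y < cnt false V
        FV< y≤ = subst (_ <_) (cnt-≡ false) (F< y≤)
        A-T : ∀ {x} → x ≤ m → oneLine α (posT x) ≡ valT x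
        A-T x≤ = A-sel true _ (T< x≤)
        A-F : ∀ {y} → y ≤ suc e → oneLine α (posF y) ≡ valF y
        A-F y≤ = A-sel false _ (F< y≤)
        posT↑ : ∀ {x} → suc x ≤ m → posT x < posT (suc x)
        posT↑ x< = sel-mono true P (+-monoʳ-< j ≤-refl) (T< x<)
        posF↑ : ∀ {y} → suc y ≤ suc e → posF y < posF (suc y)
        posF↑ y< = sel-mono false P (+-monoʳ-< i ≤-refl) (F< y<)
        posT<n : ∀ {x} → x ≤ m → posT x < n
        posT<n x≤ = subst (_ <_) lenP (sel-< true P _ (T< x≤))
        posF<n : ∀ {y} → y ≤ suc e → posF y < n
        posF<n y≤ = subst (_ <_) lenP (sel-< false P _ (F< y≤))

        gs : List ℕ
        gs = seg valF d (seg valT (suc m) [])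

        len-gs : length gs ≡ k
        len-gs = trans (length-seg valF d _) (trans (cong (d +_) (trans (length-seg valT (suc m) []) (+-identityʳ (suc m))))
          (cong (2 +_) (trans (+-suc e m) (cong suc (+-suc e m')))))

        gs↑ : Linked _<_ gs
        gs↑ = Linked-seg valF d
          (λ y h → sel-mono false V (+-monoʳ-< i ≤-refl) (FV< (≤-pred h)))
          (λ { y refl → ahead-≥ V (FV< ≤-refl) (TV< z≤n)
                 (≤-reflexive (trans (cong (ahead V) (+-comm i (suc e))) (sym (+-identityʳ j)))) })
          (Linked-seg-[] valT (suc m) (λ x h → sel-mono true V (+-monoʳ-< j ≤-refl) (TV< (≤-pred h))))

        gs-hi : ∀ {x} → x ≤ m → nth gs (d + x) ≡ valT x
        gs-hi {x} x≤ = trans (nth-seg-+ valF d _ x) (nth-seg-< valT (suc m) [] (s≤s x≤))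

        gs-k : nth gs (pred k) ≡ valT m
        gs-k = trans (cong (nth gs) (cong (2 +_) (sym (+-suc e m')))) (gs-hi ≤-refl)

        gs-lo : ∀ {y} → y ≤ suc e → nth gs y ≡ valF y
        gs-lo y≤ = nth-seg-< valF d _ (s≤s y≤)

        In : ℕ → Set
        In v = 1 ≤ v × v ≤ length gs

        in-hi : ∀ x → x < m → In (suc d + x)
        in-hi x x<m = s≤s z≤n , subst (suc d + x ≤_) (sym len-gs)
          (≤-trans (+-monoʳ-≤ (suc d) (≤-pred x<m)) (n≤1+n (3 + (e + m'))))
        in-k : In k
        in-k = s≤s z≤n , ≤-reflexive (sym len-gs)
        in-lo : ∀ y → y ≤ suc e → In (suc y)
        in-lo y y≤ = s≤s z≤n , subst (suc y ≤_) (sym len-gs) (≤-trans (s≤s y≤) (<⇒≤ d<k))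

      containsA : ahead P i ≤ j + m → Contains α (patA k d)
      containsA a≤ = subst (Contains α) (sym patA-seg) (contains α segA qs gs qs↑ qs< gs↑ range eq)
        where
        qs : List ℕ
        qs = seg posT m (posF 0 ∷ posT m ∷ seg (λ y → posF (suc y)) (suc e) [])
        i+0 : i + 0 ≡ i
        i+0 = +-identityʳ i
        i+1 : i + 1 ≡ suc i
        i+1 = +-comm i 1
        qs↑ : Linked _<_ qs
        qs↑ = Linked-seg posT m (λ x h → posT↑ (<⇒≤ h))
          (λ { x refl → ahead-< P (F< z≤n)
                 (subst (λ z → j + m' < ahead P z) (sym i+0) (≤-trans (≤-reflexive (sym (+-suc j m'))) steep₁)) })
          (ahead-≥ P (F< z≤n) (T< ≤-refl) (subst (λ z → ahead P z ≤ j + m) (sym i+0) a≤)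
            ∷ ahead-< P (F< (s≤s z≤n)) (subst (λ z → j + m < ahead P z) (sym i+1) steep₂)
            ∷ Linked-seg-[] (λ y → posF (suc y)) (suc e) (λ y h → posF↑ h))
        qs< : All (_< n) qs
        qs< = All-seg posT m (λ x h → posT<n (<⇒≤ h))
          (posF<n z≤n ∷ posT<n ≤-refl ∷ All-seg (λ y → posF (suc y)) (suc e) (λ y h → posF<n h) [])
        range : All In segA
        range = All-seg (suc d +_) m in-hi (in-lo 0 z≤n ∷ in-k ∷ All-seg (2 +_) (suc e) (λ y h → in-lo (suc y) h) [])
        eq : map (oneLine α) qs ≡ map (λ v → nth gs (pred v)) segA
        eq = trans (map-seg (oneLine α) posT m _) (trans
          (seg-cong m (λ x h → trans (A-T (<⇒≤ h)) (sym (gs-hi (<⇒≤ h))))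
            (cong₂ _∷_ (trans (A-F z≤n) (sym (gs-lo z≤n))) (cong₂ _∷_ (trans (A-T ≤-refl) (sym gs-k))
              (trans (map-seg (oneLine α) (λ y → posF (suc y)) (suc e) []) (trans
                (seg-cong (suc e) (λ y h → trans (A-F h) (sym (gs-lo h))) refl)
                (sym (map-seg (λ v → nth gs (pred v)) (2 +_) (suc e) [])))))))
          (sym (map-seg (λ v → nth gs (pred v)) (suc d +_) m _)))

      containsB : j + m < ahead P i → Contains α (patB k d)
      containsB <a = subst (Contains α) (sym patB-seg) (contains α segB qs gs qs↑ qs< gs↑ range eq)
        where
        qs : List ℕ
        qs = seg posT m (posT m ∷ seg posF d [])
        qs↑ : Linked _<_ qs
        qs↑ = Linked-seg posT m (λ x h → posT↑ (<⇒≤ h))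
          (λ { x refl → posT↑ ≤-refl })
          (ahead-< P (F< z≤n) (subst (λ z → j + m < ahead P z) (sym (+-identityʳ i)) <a)
            ∷ Linked-seg-[] posF d (λ y h → posF↑ (≤-pred h)))
        qs< : All (_< n) qs
        qs< = All-seg posT m (λ x h → posT<n (<⇒≤ h)) (posT<n ≤-refl ∷ All-seg posF d (λ y h → posF<n (≤-pred h)) [])
        range : All In segB
        range = All-seg (suc d +_) m in-hi (in-k ∷ All-seg suc d (λ y h → in-lo y (≤-pred h)) [])
        eq : map (oneLine α) qs ≡ map (λ v → nth gs (pred v)) segB
        eq = trans (map-seg (oneLine α) posT m _) (trans
          (seg-cong m (λ x h → trans (A-T (<⇒≤ h)) (sym (gs-hi (<⇒≤ h))))
            (cong₂ _∷_ (trans (A-T ≤-refl) (sym gs-k))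
              (trans (map-seg (oneLine α) posF d []) (trans
                (seg-cong d (λ y h → trans (A-F (≤-pred h)) (sym (gs-lo (≤-pred h)))) refl)
                (sym (map-seg (λ v → nth gs (pred v)) suc d []))))))
          (sym (map-seg (λ v → nth gs (pred v)) (suc d +_) m _)))

      -- Steepness leaves open on which side of remaining entry `i` the maximum of rank j + m
      -- stands; the two long patterns are the two cases.
      steep⇒contains : Contains α (patA k d) ⊎ Contains α (patB k d)
      steep⇒contains with <-≤-connex (j + m) (ahead P i)
      ... | inj₁ h = inj₂ (containsB h)
      ... | inj₂ h = inj₁ (containsA h)

  -- The words of a 321-avoiding permutation, and the bijection with accepted pairs

  at-tabulate : ∀ {n} (f : Fin n → Bool) i → at (List.tabulate f) (toℕ i) ≡ f i
  at-tabulate f Fin.zero = refl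
  at-tabulate f (Fin.suc i) = at-tabulate (λ i → f (Fin.suc i)) i

  fin : ∀ {p n} → p < n → ∃[ i ] toℕ {n} i ≡ p
  fin l = fromℕ< l , toℕ-fromℕ< l

  -- A missed value could be punched out, giving an injection from `Fin (suc n)` into `Fin n`.
  injective⇒surjective : ∀ {n} (f : Fin n → Fin n) → (∀ i j → f i ≡ f j → i ≡ j) → ∀ v → ∃[ i ] f i ≡ v
  injective⇒surjective {suc n} f f-inj v with any? (λ i → f i Fin.≟ v)
  ... | yes hit = hit
  ... | no miss = contradiction
    (injective⇒≤ {f = λ i → punchOut (v≢f i)} (λ {i} {j} e → f-inj i j (punchOut-injective (v≢f i) (v≢f j) e)))
    1+n≰n
    where
    v≢f : ∀ i → v ≢ f i
    v≢f i e = miss (i , sym e)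

  module Encode {n} (α : Vec (Fin n) n) where

    Blocked : Fin n → Set
    Blocked p = ∃[ q ] toℕ q < toℕ p × toℕ (lookup α p) < toℕ (lookup α q)

    blocked? : ∀ p → Dec (Blocked p)
    blocked? p = any? (λ q → (toℕ q <? toℕ p) ×-dec (toℕ (lookup α p) <? toℕ (lookup α q)))

    blockedValue? : ∀ v → Dec (∃[ p ] lookup α p ≡ v × Blocked p)
    blockedValue? v = any? (λ p → (lookup α p Fin.≟ v) ×-dec blocked? p)

    -- The words are computed from `α` alone, since the proofs in `AvoidingPerm` are irrelevant.
    -- Hence V searches for the position of a value instead of using an inverse permutation.
    wordP wordV : List Bool
    wordP = List.tabulate (λ p → not (does (blocked? p)))
    wordV = List.tabulate (λ v → not (does (blockedValue? v)))

    private
      A : ℕ → ℕ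
      A = oneLine α

    module _ (inj : IsPerm α) (av : Avoids α pat321) where

      private
        blockedAt : ∀ i → at wordP (toℕ i) ≡ false → Blocked i
        blockedAt i h with blocked? i | at-tabulate (λ p → not (does (blocked? p))) i
        ... | yes b | _ = b
        ... | no _ | e with () ← trans (sym h) e

        ¬blockedAt : ∀ i → at wordP (toℕ i) ≡ true → ¬ Blocked i
        ¬blockedAt i h with blocked? i | at-tabulate (λ p → not (does (blocked? p))) i
        ... | no ¬b | _ = ¬b
        ... | yes _ | e with () ← trans (sym h) e

        records : ∀ {p q} → q < p → p < n → at wordP p ≡ true → A q < A p
        records q<p p<n h with fin p<n | fin (<-trans q<p p<n)
        ... | i , refl | j , refl rewrite oneLine-lookup α i | oneLine-lookup α j with <-cmp (toℕ (lookup α j)) (toℕ (lookup α i))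
        ... | tri< l _ _ = l
        ... | tri≈ _ e _ = contradiction (cong toℕ (inj j i (toℕ-injective e))) (<⇒≢ q<p)
        ... | tri> _ _ l = contradiction (j , q<p , l) (¬blockedAt i h)

        blockeds : ∀ {p} → p < n → at wordP p ≡ false → ∃[ q ] q < p × A p < A q
        blockeds p<n h with fin p<n
        ... | i , refl with blockedAt i h
        ... | j , j<i , l = toℕ j , j<i , subst₂ _<_ (sym (oneLine-lookup α i)) (sym (oneLine-lookup α j)) l

        descent : ∀ {r p q} → r < p → p < q → q < n → A p < A r → A q < A p → Contains α pat321
        descent {r} {p} {q} r<p p<q q<n l l′ = contains α pat321 (r ∷ p ∷ q ∷ []) (A q ∷ A p ∷ A r ∷ [])
          (r<p ∷ p<q ∷ [-]) (<-trans r<p (<-trans p<q q<n) ∷ <-trans p<q q<n ∷ q<n ∷ []) (l′ ∷ l ∷ [-])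
          ((s≤s z≤n , s≤s (s≤s (s≤s z≤n))) ∷ (s≤s z≤n , s≤s (s≤s z≤n)) ∷ (s≤s z≤n , s≤s z≤n) ∷ []) refl

        monotone : ∀ {p q} → p < q → q < n → at wordP p ≡ at wordP q → A p < A q
        monotone {p} {q} p<q q<n h with at wordP q in eq
        ... | true = records p<q q<n eq
        ... | false with blockeds (<-trans p<q q<n) h | <-cmp (A p) (A q)
        ... | _ | tri< l _ _ = l
        -- An inversion between two remaining entries, preceded by an entry exceeding the first, is
        -- a 321.
        ... | r , r<p , l | tri> _ _ l′ = contradiction (descent r<p p<q q<n l l′) av
        ... | _ | tri≈ _ e _ with fin (<-trans p<q q<n) | fin q<n
        ... | i , refl | j , refl = contradiction
          (cong toℕ (inj i j (toℕ-injective (trans (sym (oneLine-lookup α i)) (trans e (oneLine-lookup α j)))))) (<⇒≢ p<q)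

      coded : Coded n A wordP wordV
      coded = record
        { lenP = Listₚ.length-tabulate _
        ; lenV = Listₚ.length-tabulate _
        ; bounded = bounded
        ; onto = onto
        ; same = same
        ; mono = monotone
        ; blocked = blockeds
        ; maximal = records
        }
        where
        bounded : ∀ {p} → p < n → A p < n
        bounded l with fin l
        ... | i , refl = subst (_< n) (sym (oneLine-lookup α i)) (toℕ<n (lookup α i))
        onto : ∀ {v} → v < n → ∃[ p ] p < n × A p ≡ v
        onto l with fin l
        ... | w , refl with injective⇒surjective (lookup α) inj w
        ... | i , e = toℕ i , toℕ<n i , trans (oneLine-lookup α i) (cong toℕ e)
        same : ∀ {p} → p < n → at wordV (A p) ≡ at wordP p
        same l with fin l
        ... | i , refl = begin
          at wordV (A (toℕ i))                     ≡⟨ cong (at wordV) (oneLine-lookup α i) ⟩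
          at wordV (toℕ (lookup α i))              ≡⟨ at-tabulate (λ v → not (does (blockedValue? v))) (lookup α i) ⟩
          not (does (blockedValue? (lookup α i)))  ≡⟨ cong not (does-⇔ (mk⇔
            (λ (j , e , b) → subst Blocked (inj j i e) b) (λ b → i , refl , b)) (blockedValue? (lookup α i)) (blocked? i)) ⟩
          not (does (blocked? i))                  ≡⟨ at-tabulate (λ p → not (does (blocked? p))) i ⟨
          at wordP (toℕ i) ∎
          where open ≡-Reasoning

  Coded-cong : ∀ {n A B P V} → (∀ {p} → p < n → A p ≡ B p) → Coded n A P V → Coded n B P V
  Coded-cong {P = P} {V} h c = record
    { lenP = lenP ; lenV = lenV
    ; bounded = λ l → subst (_< _) (h l) (bounded l)
    ; onto = λ l → let (p , p<n , e) = onto l in p , p<n , trans (sym (h p<n)) e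
    ; same = λ l → trans (cong (at V) (sym (h l))) (same l)
    ; mono = λ p<q q<n e → subst₂ _<_ (h (<-trans p<q q<n)) (h q<n) (mono p<q q<n e)
    ; blocked = λ l e → let (q , q<p , l′) = blocked l e in q , q<p , subst₂ _<_ (h l) (h (<-trans q<p l)) l′
    ; maximal = λ q<p l e → subst₂ _<_ (h (<-trans q<p l)) (h l) (maximal q<p l e)
    }
    where open Coded c

  Coded-injective : ∀ {n A P V} → Coded n A P V → ∀ {p q} → p < n → q < n → A p ≡ A q → p ≡ q
  Coded-injective {V = V} c {p} {q} p<n q<n e with <-cmp p q
  ... | tri≈ _ p≡q _ = p≡q
  ... | tri< l _ _ = contradiction e (<⇒≢ (mono l q<n (trans (sym (same p<n)) (trans (cong (at V) e) (same q<n)))))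
    where open Coded c
  ... | tri> _ _ l = contradiction (sym e) (<⇒≢ (mono l p<n (trans (sym (same q<n)) (trans (cong (at V) (sym e)) (same p<n)))))
    where open Coded c

  oneLine-tabulate : ∀ {m n} (f : Fin n → Fin m) i → oneLine (tabulate f) (toℕ i) ≡ toℕ (f i)
  oneLine-tabulate f i = trans (oneLine-lookup (tabulate f) i) (cong toℕ (Vecₚ.lookup∘tabulate f i))

  module Bijection (e m' n : ℕ) where
    open Machine e m'
    open Patterns e m' using (k; d; patA-seg; patB-seg; steepA; steepB; steep⇒contains)

    decoded : ∀ {P V} → length P ≡ n → Inv (lo 0 e) P V → Coded n (value P V) P V
    decoded {P} {V} l (_ , core t f a _) = Decode.coded l (λ { true → t ; false → f }) a

    decode : Accept (lo 0 e) n → Vec (Fin n) n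
    decode (acc P V l i) = tabulate (λ p → fromℕ< (Coded.bounded (decoded l i) (toℕ<n p)))

    decode-value : ∀ x {p} → p < n → value (Accept.P x) (Accept.V x) p ≡ oneLine (decode x) p
    decode-value x l with fin l
    ... | i , refl = sym (trans (oneLine-tabulate _ i) (toℕ-fromℕ< _))

    decode-coded : ∀ P V (l : length P ≡ n) (i : Inv (lo 0 e) P V) → Coded n (oneLine (decode (acc P V l i))) P V
    decode-coded P V l i = Coded-cong (decode-value (acc P V l i)) (decoded l i)

    coded-perm : ∀ α {P V} → Coded n (oneLine α) P V → IsPerm α
    coded-perm α c i j eq = toℕ-injective (Coded-injective c (toℕ<n i) (toℕ<n j)
      (trans (oneLine-lookup α i) (trans (cong toℕ eq) (sym (oneLine-lookup α j)))))

    true≢false : true ≢ false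
    true≢false ()

    -- The middle entry of a 321 would be the lower end of one inversion and the upper end of
    -- another, hence both remaining and maximal.
    coded-321 : ∀ α {P V} → Coded n (oneLine α) P V → Avoids α pat321
    coded-321 α c o = true≢false
        (trans (sym (proj₁ (inversion (mono 1<2 2<3) (index< 2<3) (Equivalence.from (order 2<3 1<3) ≤-refl))))
               (proj₂ (inversion (mono 0<1 1<3) (index< 1<3) (Equivalence.from (order 1<3 0<3) ≤-refl))))
      where
      open CodedProperties c
      open Occurrence (Contains⇒Occurrence α pat321 o)
      0<1 : 0 < 1
      0<1 = ≤-refl
      1<2 : 1 < 2
      1<2 = ≤-refl
      0<3 : 0 < 3
      0<3 = s≤s z≤n
      1<3 : 1 < 3
      1<3 = s≤s (s≤s z≤n)
      2<3 : 2 < 3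
      2<3 = ≤-refl

    coded-A : ∀ α {P V} → Coded n (oneLine α) P V → Inv (lo 0 e) P V → Avoids α (patA k d)
    coded-A α c (_ , core _ _ _ gentle) o =
      let (i , l , s) = steepA c (subst (Occurrence n (oneLine α)) patA-seg (Contains⇒Occurrence α (patA k d) o))
      in gentle i l s

    coded-B : ∀ α {P V} → Coded n (oneLine α) P V → Inv (lo 0 e) P V → Avoids α (patB k d)
    coded-B α c (_ , core _ _ _ gentle) o =
      let (i , l , s) = steepB c (subst (Occurrence n (oneLine α)) patB-seg (Contains⇒Occurrence α (patB k d) o))
      in gentle i l s

    decode-avoids : ∀ P V (l : length P ≡ n) (i : Inv (lo 0 e) P V) → let α = decode (acc P V l i) in
      IsPerm α × Avoids α pat321 × Avoids α (patA k d) × Avoids α (patB k d)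
    decode-avoids P V l i = coded-perm α c , coded-321 α c , coded-A α c i , coded-B α c i
      where
      α = decode (acc P V l i)
      c = decode-coded P V l i

    from : Accept (lo 0 e) n → AvoidingPerm k d n
    from (acc P V l i) = mkAP (decode (acc P V l i))
      (proj₁ (decode-avoids P V l i)) (proj₁ (proj₂ (decode-avoids P V l i)))
      (proj₁ (proj₂ (proj₂ (decode-avoids P V l i)))) (proj₂ (proj₂ (proj₂ (decode-avoids P V l i))))

    encode-inv : ∀ α → IsPerm α → Avoids α pat321 → Avoids α (patA k d) → Avoids α (patB k d) →
                 Inv (lo 0 e) (Encode.wordP α) (Encode.wordV α)
    encode-inv α inj av avA avB = refl , core (cnt-≡ true) (cnt-≡ false) above gentle
      where
      c = Encode.coded {n} α inj av
      open CodedProperties c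
      P = Encode.wordP α
      V = Encode.wordV α
      gentle : ∀ i → suc e + i < cnt false V → ¬ Steep 0 (ahead V (suc e + i)) (ahead P i) (ahead P (suc i))
      gentle i l (s₁ , s₂) = [ avA , avB ]′ (steep⇒contains {n} α {P} {V} c i l s₁ s₂)

    to : AvoidingPerm k d n → Accept (lo 0 e) n
    to (mkAP α inj av avA avB) = acc (Encode.wordP α) (Encode.wordV α)
      (Coded.lenP {n} {oneLine α} (Encode.coded {n} α inj av)) (encode-inv α inj av avA avB)

    mkAP-≡ : ∀ {x y : AvoidingPerm k d n} → AvoidingPerm.perm x ≡ AvoidingPerm.perm y → x ≡ y
    mkAP-≡ refl = refl

    acc-≡ : ∀ {x y : Accept (lo 0 e) n} → Accept.P x ≡ Accept.P y → Accept.V x ≡ Accept.V y → x ≡ y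
    acc-≡ refl refl = refl

    encode-decode : ∀ P V (l : length P ≡ n) (i : Inv (lo 0 e) P V) →
      Encode.wordP (decode (acc P V l i)) ≡ P × Encode.wordV (decode (acc P V l i)) ≡ V
    encode-decode P V l i = unique (Encode.coded {n} α (coded-perm α c) (coded-321 α c)) c
      where
      α = decode (acc P V l i)
      c = decode-coded P V l i

    to∘from : ∀ x → to (from x) ≡ x
    to∘from (acc P V l i) = acc-≡
      -- The equality rests on irrelevant proofs; decidability of equality of words makes it
      -- relevant again.
      (recompute (Listₚ.≡-dec Bool._≟_ _ P) (proj₁ (encode-decode P V l i)))
      (recompute (Listₚ.≡-dec Bool._≟_ _ V) (proj₂ (encode-decode P V l i)))

    decode-encode : ∀ α (inj : IsPerm α) (av : Avoids α pat321) (p : Fin n) →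
      value (Encode.wordP α) (Encode.wordV α) (toℕ p) ≡ toℕ (lookup α p)
    decode-encode α inj av p = trans
      (sym (CodedProperties.A-rank (Encode.coded {n} α inj av) (toℕ<n p) refl)) (oneLine-lookup α p)

    from∘to : ∀ x → from (to x) ≡ x
    from∘to (mkAP α inj av avA avB) = mkAP-≡ (trans
      (Vecₚ.tabulate-cong λ p → recompute (_ Fin.≟ _)
        (toℕ-injective (trans (toℕ-fromℕ< _) (decode-encode α inj av p))))
      (Vecₚ.tabulate∘lookup α))

    bijection : AvoidingPerm k d n ↔ Accept (lo 0 e) n
    bijection = mk↔ₛ′ to from to∘from from∘to

module GeneratingFunctions where

  open Bijections using (module Machine)
  open import Data.Nat as ℕ using (ℕ; zero; suc; z≤n; s≤s; _∸_)
  import Data.Nat.Properties as ℕₚ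
  open import Data.Nat.Combinatorics using
    (_C_; nC1≡n; nCn≡1; nCk+nC[k+1]≡[n+1]C[k+1]; k>n⇒nCk≡0; nCk≡nC[n∸k])
  import Data.Nat.Coprimality as Coprimality
  open import Data.Nat.DivMod using (m*n/n≡m)
  open import Data.Nat.Tactic.RingSolver using () renaming (solve-∀ to ℕ-solve-∀)
  open import Data.Integer as ℤ using (ℤ; +_; _+_; _*_; _-_; -_)
  open import Data.Integer.Properties
  open import Data.Integer.Tactic.RingSolver using (solve-∀)
  open import Data.Rational as ℚ using (ℚ; mkℚ)
  import Data.Rational.Properties as ℚₚ
  open ≡-Reasoning

  -- Formal power series and the Chebyshev ratio

  Series : Set
  Series = ℕ → ℤ

  δ : Series
  δ zero = + 1
  δ (suc n) = + 0

  S : Series → Series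
  S f zero = + 0
  S f (suc n) = f n

  infixl 6 _⊕_ _⊖_
  _⊕_ _⊖_ : Series → Series → Series
  (f ⊕ g) n = f n + g n
  (f ⊖ g) n = f n - g n

  S-cong : ∀ {f g} → f ≗ g → S f ≗ S g
  S-cong h zero = refl
  S-cong h (suc n) = h n

  S-⊕ : ∀ f g → S (f ⊕ g) ≗ S f ⊕ S g
  S-⊕ f g zero = refl
  S-⊕ f g (suc n) = refl

  S-⊖ : ∀ f g → S (f ⊖ g) ≗ S f ⊖ S g
  S-⊖ f g zero = refl
  S-⊖ f g (suc n) = refl

  S^ : ℕ → Series → Series
  S^ zero f = f
  S^ (suc r) f = S (S^ r f)

  S^-cong : ∀ r {f g} → f ≗ g → S^ r f ≗ S^ r g
  S^-cong zero h = h
  S^-cong (suc r) h = S-cong (S^-cong r h)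

  S^-S : ∀ r f → S^ r (S f) ≗ S (S^ r f)
  S^-S zero f n = refl
  S^-S (suc r) f = S-cong (S^-S r f)

  S^-⊖ : ∀ r f g → S^ r (f ⊖ g) ≗ S^ r f ⊖ S^ r g
  S^-⊖ zero f g n = refl
  S^-⊖ (suc r) f g n = trans (S-cong (S^-⊖ r f g) n) (S-⊖ (S^ r f) (S^ r g) n)

  S^-⊕ : ∀ r f g → S^ r (f ⊕ g) ≗ S^ r f ⊕ S^ r g
  S^-⊕ zero f g n = refl
  S^-⊕ (suc r) f g n = trans (S-cong (S^-⊕ r f g) n) (S-⊕ (S^ r f) (S^ r g) n)

  infixl 7 _⊛_
  _⊛_ : Series → Series → Series
  (f ⊛ c) zero = f 0 * c 0
  (f ⊛ c) (suc n) = f 0 * c (suc n) + ((λ i → f (suc i)) ⊛ c) n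

  ⊛-congˡ : ∀ {f g} c → f ≗ g → f ⊛ c ≗ g ⊛ c
  ⊛-congˡ c h zero = cong (_* c 0) (h 0)
  ⊛-congˡ c h (suc n) = cong₂ _+_ (cong (_* c (suc n)) (h 0)) (⊛-congˡ c (λ i → h (suc i)) n)

  ⊛-congʳ : ∀ f {c d} → c ≗ d → f ⊛ c ≗ f ⊛ d
  ⊛-congʳ f h zero = cong (f 0 *_) (h 0)
  ⊛-congʳ f h (suc n) = cong₂ _+_ (cong (f 0 *_) (h (suc n))) (⊛-congʳ (λ i → f (suc i)) h n)

  ⊛-Sˡ : ∀ f c → S f ⊛ c ≗ S (f ⊛ c)
  ⊛-Sˡ f c zero = refl
  ⊛-Sˡ f c (suc n) = +-identityˡ _

  ⊛-Sʳ : ∀ f c → f ⊛ S c ≗ S (f ⊛ c)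
  ⊛-Sʳ f c zero = *-zeroʳ (f 0)
  ⊛-Sʳ f c (suc zero) = trans (cong (_+_ (f 0 * c 0)) (*-zeroʳ (f 1))) (+-identityʳ (f 0 * c 0))
  ⊛-Sʳ f c (suc (suc n)) = cong (_+_ (f 0 * c (suc n))) (⊛-Sʳ (λ i → f (suc i)) c (suc n))

  ⊛-⊖ˡ : ∀ f g c → (f ⊖ g) ⊛ c ≗ f ⊛ c ⊖ g ⊛ c
  ⊛-⊖ˡ f g c zero = lemma (f 0) (g 0) (c 0)
    where lemma : ∀ a b x → (a - b) * x ≡ a * x - b * x
          lemma = solve-∀
  ⊛-⊖ˡ f g c (suc n) = trans
    (cong (_+_ ((f 0 - g 0) * c (suc n))) (⊛-⊖ˡ (λ i → f (suc i)) (λ i → g (suc i)) c n))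
    (lemma (f 0) (g 0) (c (suc n)) (((λ i → f (suc i)) ⊛ c) n) (((λ i → g (suc i)) ⊛ c) n))
    where lemma : ∀ a b x u v → (a - b) * x + (u - v) ≡ (a * x + u) - (b * x + v)
          lemma = solve-∀

  ⊛-⊖ʳ : ∀ f c d → f ⊛ (c ⊖ d) ≗ f ⊛ c ⊖ f ⊛ d
  ⊛-⊖ʳ f c d zero = lemma (f 0) (c 0) (d 0)
    where lemma : ∀ a x y → a * (x - y) ≡ a * x - a * y
          lemma = solve-∀
  ⊛-⊖ʳ f c d (suc n) = trans
    (cong (_+_ (f 0 * (c (suc n) - d (suc n)))) (⊛-⊖ʳ (λ i → f (suc i)) c d n))
    (lemma (f 0) (c (suc n)) (d (suc n)) (((λ i → f (suc i)) ⊛ c) n) (((λ i → f (suc i)) ⊛ d) n))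
    where lemma : ∀ a x y u v → a * (x - y) + (u - v) ≡ (a * x + u) - (a * y + v)
          lemma = solve-∀

  ⊛-⊕ʳ : ∀ f c d → f ⊛ (c ⊕ d) ≗ f ⊛ c ⊕ f ⊛ d
  ⊛-⊕ʳ f c d zero = *-distribˡ-+ (f 0) (c 0) (d 0)
  ⊛-⊕ʳ f c d (suc n) = trans
    (cong (_+_ (f 0 * (c (suc n) + d (suc n)))) (⊛-⊕ʳ (λ i → f (suc i)) c d n))
    (lemma (f 0) (c (suc n)) (d (suc n)) (((λ i → f (suc i)) ⊛ c) n) (((λ i → f (suc i)) ⊛ d) n))
    where lemma : ∀ a x y u v → a * (x + y) + (u + v) ≡ (a * x + u) + (a * y + v)
          lemma = solve-∀

  ⊛-δʳ : ∀ f → f ⊛ δ ≗ f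
  ⊛-δʳ f zero = *-identityʳ (f 0)
  ⊛-δʳ f (suc n) = trans (cong₂ _+_ (*-zeroʳ (f 0)) (⊛-δʳ (λ i → f (suc i)) n)) (+-identityˡ _)

  ⊛-zeroˡ : ∀ c → (λ _ → + 0) ⊛ c ≗ (λ _ → + 0)
  ⊛-zeroˡ c zero = refl
  ⊛-zeroˡ c (suc n) = trans (+-identityˡ _) (⊛-zeroˡ c n)

  ⊛-δˡ : ∀ c → δ ⊛ c ≗ c
  ⊛-δˡ c zero = *-identityˡ (c 0)
  ⊛-δˡ c (suc n) = trans (cong₂ _+_ (*-identityˡ (c (suc n))) (⊛-zeroˡ c n)) (+-identityʳ _)

  -- V m = x^{m/2} U_m(1/(2√x)).
  V : ℕ → Series
  V zero = δ
  V (suc zero) = δ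
  V (suc (suc m)) = V (suc m) ⊖ S (V m)

  -- The cleared denominator and numerator for k = i + 4.
  D N : ℕ → Series
  D i = V (4 ℕ.+ i) ⊕ S (S (V (2 ℕ.+ i)))
  N i = V (3 ℕ.+ i) ⊕ S (S (V (1 ℕ.+ i)))

  -- As `N (suc i)` is `D i` by definition, this is the other half of the step from the pair (N, D)
  -- at `i` to the pair at `suc i`.
  D-suc : ∀ i → D (suc i) ≗ D i ⊖ S (N i)
  D-suc i n = begin
    (V (4 ℕ.+ i) n - S (V (3 ℕ.+ i)) n) + S (S (V (2 ℕ.+ i) ⊖ S (V (1 ℕ.+ i)))) n
      ≡⟨ cong (_+_ (V (4 ℕ.+ i) n - S (V (3 ℕ.+ i)) n))
           (trans (S-cong (S-⊖ (V (2 ℕ.+ i)) (S (V (1 ℕ.+ i)))) n) (S-⊖ (S (V (2 ℕ.+ i))) (S (S (V (1 ℕ.+ i)))) n)) ⟩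
    (V (4 ℕ.+ i) n - S (V (3 ℕ.+ i)) n) + (S (S (V (2 ℕ.+ i))) n - S (S (S (V (1 ℕ.+ i)))) n)
      ≡⟨ lemma (V (4 ℕ.+ i) n) (S (V (3 ℕ.+ i)) n) _ _ ⟩
    (V (4 ℕ.+ i) n + S (S (V (2 ℕ.+ i))) n) - (S (V (3 ℕ.+ i)) n + S (S (S (V (1 ℕ.+ i)))) n)
      ≡⟨ cong (_-_ (V (4 ℕ.+ i) n + S (S (V (2 ℕ.+ i))) n)) (S-⊕ (V (3 ℕ.+ i)) (S (S (V (1 ℕ.+ i)))) n) ⟨
    _ ∎
    where lemma : ∀ a b c d → (a - b) + (c - d) ≡ (a + c) - (b + d)
          lemma = solve-∀

  ⊛-V : ∀ f m → f ⊛ V (suc (suc m)) ≗ f ⊛ V (suc m) ⊖ S (f ⊛ V m)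
  ⊛-V f m n = trans (⊛-⊖ʳ f (V (suc m)) (S (V m)) n) (cong (_-_ ((f ⊛ V (suc m)) n)) (⊛-Sʳ f (V m) n))

  ⊛-D-suc : ∀ f i → f ⊛ D (suc i) ≗ f ⊛ D i ⊖ S (f ⊛ N i)
  ⊛-D-suc f i n = begin
    (f ⊛ D (suc i)) n              ≡⟨ ⊛-congʳ f (D-suc i) n ⟩
    (f ⊛ (D i ⊖ S (N i))) n        ≡⟨ ⊛-⊖ʳ f (D i) (S (N i)) n ⟩
    (f ⊛ D i) n - (f ⊛ S (N i)) n  ≡⟨ cong (_-_ ((f ⊛ D i) n)) (⊛-Sʳ f (N i) n) ⟩
    _ ∎

  -- y : w = N i : D i.
  infix 4 _∼[_]_
  _∼[_]_ : Series → ℕ → Series → Set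
  y ∼[ i ] w = y ⊛ D i ≗ w ⊛ N i

  -- With x the variable, the hypotheses give (y - w) D = x y N at `i`, that is y (D - x N) = w D,
  -- and D - x N and D are the next denominator and numerator.
  ∼-step : ∀ {i y y⁺ w} → y⁺ ≗ y ⊖ w → y⁺ ∼[ i ] S y → y ∼[ suc i ] w
  ∼-step {i} {y} {y⁺} {w} eq h n = begin
    (y ⊛ D (suc i)) n                 ≡⟨ ⊛-D-suc y i n ⟩
    (y ⊛ D i) n - S (y ⊛ N i) n       ≡⟨ cong (_-_ ((y ⊛ D i) n)) (⊛-Sˡ y (N i) n) ⟨
    (y ⊛ D i) n - (S y ⊛ N i) n       ≡⟨ cong (_-_ ((y ⊛ D i) n)) (h n) ⟨
    (y ⊛ D i) n - (y⁺ ⊛ D i) n        ≡⟨ cong (_-_ ((y ⊛ D i) n)) (trans (⊛-congˡ (D i) eq n) (⊛-⊖ˡ y w (D i) n)) ⟩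
    (y ⊛ D i) n - ((y ⊛ D i) n - (w ⊛ D i) n) ≡⟨ lemma ((y ⊛ D i) n) ((w ⊛ D i) n) ⟩
    (w ⊛ D i) n ∎
    where lemma : ∀ a b → a - (a - b) ≡ b
          lemma = solve-∀

  -- With t for the variable, the hypotheses read (1 - t) y - w = t x and (1 - t)^2 x = t y.
  -- Eliminating the series `x` gives ((1 - t)^3 - t^2) y = (1 - t)^2 w, whose factors are `D 0` and
  -- `N 0`.
  ∼-base : ∀ {y w x} → y ⊖ w ≗ S x ⊕ S y → (x ⊖ S x) ⊖ S (x ⊖ S x) ≗ S y → y ∼[ 0 ] w
  ∼-base {y} {w} {x} yw xy n = begin
    (y ⊛ D 0) n ≡⟨ ⊛-⊕ʳ y (V 4) (S (S (V 2))) n ⟩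
    (y ⊛ V 4) n + (y ⊛ S (S (V 2))) n
      ≡⟨ cong₂ _+_ (trans (⊛-V y 2 n) (cong₂ _-_ (v3 y n) (trans (S-cong (v2 y) n) (S-⊖ y (S y) n))))
                   (trans (⊛-Sʳ y (S (V 2)) n) (trans (S-cong (⊛-Sʳ y (V 2)) n)
                     (trans (S-cong (S-cong (v2 y)) n) (trans (S-cong (S-⊖ y (S y)) n) (S-⊖ _ _ n))))) ⟩
    (((y n - S y n) - S y n) - (S y n - S (S y) n)) + (S (S y) n - S (S (S y)) n)
      ≡⟨ lemma₁ (y n) (S y n) (S (S y) n) (S (S (S y)) n) (S x n) (S (S x) n) (S (S (S x)) n) (S (S y) n) Sxy refl ⟩
    ((w′ - Sw′) - Sw′) + SSw′
      ≡⟨ cong₂ _+_ (cong₂ _-_ (cong₂ _-_ (w-eq n) (Sw n)) (Sw n)) (SSw n) ⟨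
    ((w n - S w n) - S w n) + S (S w) n
      ≡⟨ cong₂ _+_ (v3 w n) (trans (⊛-Sʳ w (S (V 1)) n) (S-cong (λ k → trans (⊛-Sʳ w (V 1) k) (S-cong (⊛-δʳ w) k)) n)) ⟨
    (w ⊛ V 3) n + (w ⊛ S (S (V 1))) n ≡⟨ ⊛-⊕ʳ w (V 3) (S (S (V 1))) n ⟨
    (w ⊛ N 0) n ∎
    where
    v2 : ∀ f → f ⊛ V 2 ≗ f ⊖ S f
    v2 f n = trans (⊛-V f 0 n) (cong₂ _-_ (⊛-δʳ f n) (S-cong (⊛-δʳ f) n))
    v3 : ∀ f → f ⊛ V 3 ≗ f ⊖ S f ⊖ S f
    v3 f n = trans (⊛-V f 1 n) (cong₂ _-_ (v2 f n) (S-cong (⊛-δʳ f) n))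
    w-eq : w ≗ y ⊖ (S x ⊕ S y)
    w-eq k = trans (sym (lemma (y k) (w k))) (cong (_-_ (y k)) (yw k))
      where lemma : ∀ a b → a - (a - b) ≡ b
            lemma = solve-∀
    w′ = y n - (S x n + S y n)
    Sw′ = S y n - (S (S x) n + S (S y) n)
    SSw′ = S (S y) n - (S (S (S x)) n + S (S (S y)) n)
    Sw-eq : S w ≗ S y ⊖ (S (S x) ⊕ S (S y))
    Sw-eq k = trans (S-cong w-eq k) (trans (S-⊖ y (S x ⊕ S y) k) (cong (_-_ (S y k)) (S-⊕ (S x) (S y) k)))
    Sw : ∀ k → S w k ≡ S y k - (S (S x) k + S (S y) k)
    Sw = Sw-eq
    SSw : ∀ k → S (S w) k ≡ S (S y) k - (S (S (S x)) k + S (S (S y)) k)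
    SSw k = trans (S-cong Sw-eq k) (trans (S-⊖ (S y) (S (S x) ⊕ S (S y)) k) (cong (_-_ (S (S y) k)) (S-⊕ (S (S x)) (S (S y)) k)))
    Sxy : (S x n - S (S x) n) - (S (S x) n - S (S (S x)) n) ≡ S (S y) n
    Sxy = trans (sym (trans (S-⊖ _ _ n) (cong₂ _-_ (S-⊖ _ _ n) (trans (S-cong (S-⊖ _ _) n) (S-⊖ _ _ n))))) (S-cong xy n)
    lemma₁ : ∀ a b c d p q s t → (p - q) - (q - s) ≡ t → t ≡ c →
      (((a - b) - b) - (b - c)) + (c - d) ≡
      (((a - (p + b)) - (b - (q + c))) - (b - (q + c))) + (c - (s + d))
    lemma₁ a b c d p q s t refl refl = lemma a b d p q s
      where lemma : ∀ a b d p q s → (((a - b) - b) - (b - ((p - q) - (q - s)))) + (((p - q) - (q - s)) - d) ≡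
              (((a - (p + b)) - (b - (q + ((p - q) - (q - s))))) - (b - (q + ((p - q) - (q - s))))) + (((p - q) - (q - s)) - (s + d))
            lemma = solve-∀

  -- Generating functions of the automaton

  module Count (e m' : ℕ) where
    open Machine e m'

    lo# loR# hi# xp# : ℕ → ℕ → Series
    lo# j g p = + #lo j g p
    loR# j g p = + #loR j g p
    hi# r q p = + #hi r q p
    xp# r q p = + #xp r q p

    -- The term subtracted in the recursion: x times the previous series, with 1 in its place at
    -- height 0. `hi⁻` continues it past lag `e`.
    lo⁻ : ℕ → ℕ → Series
    lo⁻ zero g = δ
    lo⁻ (suc j) g = S (lo# j (suc g))

    hi⁻ : ℕ → ℕ → Series
    hi⁻ zero q = lo⁻ e 0
    hi⁻ (suc r) q = S^ (suc r) (hi# r (suc q))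

    lo-eq : ∀ j g → lo# j g ≗ lo⁻ j g ⊕ S (loR# j g)
    lo-eq zero g zero = refl
    lo-eq (suc j) g zero = refl
    lo-eq zero g (suc p) = refl
    lo-eq (suc j) g (suc p) = refl

    -- The two successors of `lo` at lag `suc j` are those of `loR` at lag `j`, so the left side is
    -- x times the latter; the same product is what `lo` at lag `j` has besides `lo⁻`.
    lo-step : ∀ j g → lo# (suc j) g ≗ lo# j (suc g) ⊖ lo⁻ j (suc g)
    lo-step j g n = begin
      lo# (suc j) g n                                     ≡⟨ lo-eq (suc j) g n ⟩
      S (lo# j (suc g)) n + S (loR# (suc j) g) n          ≡⟨ S-⊕ (lo# j (suc g)) (loR# (suc j) g) n ⟨
      S (loR# j (suc g)) n                                ≡⟨ lemma (lo⁻ j (suc g) n) (S (loR# j (suc g)) n) ⟩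
      (lo⁻ j (suc g) n + S (loR# j (suc g)) n) - lo⁻ j (suc g) n
                                                          ≡⟨ cong (λ z → z - lo⁻ j (suc g) n) (lo-eq j (suc g) n) ⟨
      lo# j (suc g) n - lo⁻ j (suc g) n ∎
      where lemma : ∀ a b → b ≡ (a + b) - a
            lemma = solve-∀

    xp-eq : ∀ r q → xp# r (suc q) ≗ S (xp# (suc r) q ⊕ hi# (suc r) (suc q))
    xp-eq r q zero = refl
    xp-eq r q (suc p) = refl

    -- The factor x^r turns hi# r into the (e+r)-th term of the sequence begun by the lower levels.
    hi-prev : ∀ r q → r ℕ.+ q ≡ m' → S^ r (hi# r (suc q)) ⊖ hi⁻ r (suc q) ≗ S (S^ r (hi# r (suc q) ⊕ xp# r q))
    hi-prev zero q refl n = begin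
      lo# e 0 n - lo⁻ e 0 n                              ≡⟨ cong (λ z → z - lo⁻ e 0 n) (lo-eq e 0 n) ⟩
      (lo⁻ e 0 n + S (loR# e 0) n) - lo⁻ e 0 n           ≡⟨ lemma (lo⁻ e 0 n) (S (loR# e 0) n) ⟩
      S (loR# e 0) n                                     ≡⟨ S-cong (λ _ → refl) n ⟩
      S (lo# e 0 ⊕ xp# 0 q) n ∎
      where lemma : ∀ a b → (a + b) - a ≡ b
            lemma = solve-∀
    hi-prev (suc r) q eq n = begin
      S^ (suc r) (hi# (suc r) (suc q)) n - S^ (suc r) (hi# r (suc (suc q))) n
        ≡⟨ S^-⊖ (suc r) (hi# (suc r) (suc q)) (hi# r (suc (suc q))) n ⟨
      S^ (suc r) (hi# (suc r) (suc q) ⊖ hi# r (suc (suc q))) n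
        -- The difference of two consecutive `hi` series is `xp# r`, and one letter of P leads from
        -- there to `xp# (suc r)` or `hi# (suc r)`.
        ≡⟨ S^-cong (suc r) (λ p → trans (lemma (hi# r (suc (suc q)) p) (xp# r (suc q) p)) (xp-eq r q p)) n ⟩
      S^ (suc r) (S (xp# (suc r) q ⊕ hi# (suc r) (suc q))) n
        ≡⟨ S^-S (suc r) (xp# (suc r) q ⊕ hi# (suc r) (suc q)) n ⟩
      S (S^ (suc r) (xp# (suc r) q ⊕ hi# (suc r) (suc q))) n
        ≡⟨ S-cong (S^-cong (suc r) (λ p → +-comm (xp# (suc r) q p) (hi# (suc r) (suc q) p))) n ⟩
      S (S^ (suc r) (hi# (suc r) (suc q) ⊕ xp# (suc r) q)) n ∎
      where lemma : ∀ a b → (a + b) - a ≡ b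
            lemma = solve-∀

    #top-≡ : ∀ x p → #top x p ≡ #hi m 0 p
    #top-≡ zero p = refl
    #top-≡ (suc x) p = #top-≡ x p

    -- States above lead `m` fall back to it without consuming P, so all `top` counts coincide.
    -- Every `xpt`, and `xp` at its highest level, then unfolds by the same recursion.
    #xpt-≡ : ∀ x p → #xpt x p ≡ #xp m' 0 p
    #xpt-≡ x zero = refl
    #xpt-≡ x (suc p) = cong₂ ℕ._+_ (trans (#xpt-≡ (suc x) p) (sym (#xpt-≡ 0 p))) (#top-≡ x p)

    xp-top : xp# m' 0 ⊖ S (xp# m' 0) ≗ S (hi# m 0)
    xp-top zero = refl
    xp-top (suc p) rewrite #xpt-≡ 0 p = lemma (xp# m' 0 p) (hi# m 0 p)
      where lemma : ∀ a b → (a + b) - a ≡ b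
            lemma = solve-∀

    hi-top : hi# m 0 ⊖ S (hi# m 0) ≗ hi# m' 1
    hi-top zero = +-identityʳ (hi# m' 1 0)
    hi-top (suc p) = lemma (hi# m' 1 (suc p)) (hi# m 0 p)
      where lemma : ∀ a b → (a + b) - b ≡ a
            lemma = solve-∀

    -- For the boundary series X = `xp# m' 0` and K = `hi# m 0`, (1 - x) X = x K and (1 - x) K =
    -- `hi# m' 1`. Eliminating K gives the second hypothesis of `∼-base`.
    ∼-top : S^ m' (hi# m' 1) ∼[ 0 ] hi⁻ m' 1
    ∼-top = ∼-base {x = x}
      (λ n → trans (hi-prev m' 0 (ℕₚ.+-identityʳ m') n)
               (trans (S-cong (S^-⊕ m' H X) n)
                 (trans (S-⊕ (S^ m' H) x n) (+-comm (S (S^ m' H) n) (S x n)))))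
      (λ n → begin
        ((x ⊖ S x) ⊖ S (x ⊖ S x)) n         ≡⟨ cong₂ _-_ (x-Sx n) (S-cong x-Sx n) ⟩
        (S (S^ m' K) ⊖ S (S (S^ m' K))) n   ≡⟨ S-⊖ (S^ m' K) (S (S^ m' K)) n ⟨
        S (S^ m' K ⊖ S (S^ m' K)) n         ≡⟨ S-cong (λ k → cong (_-_ (S^ m' K k)) (sym (S^-S m' K k))) n ⟩
        S (S^ m' K ⊖ S^ m' (S K)) n         ≡⟨ S-cong (λ k → sym (S^-⊖ m' K (S K) k)) n ⟩
        S (S^ m' (K ⊖ S K)) n               ≡⟨ S-cong (S^-cong m' hi-top) n ⟩
        S (S^ m' H) n ∎)
      where
      H = hi# m' 1
      K = hi# m 0
      X = xp# m' 0
      x = S^ m' X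
      x-Sx : x ⊖ S x ≗ S (S^ m' K)
      x-Sx k = begin
        x k - S x k              ≡⟨ cong (_-_ (x k)) (S^-S m' X k) ⟨
        x k - S^ m' (S X) k      ≡⟨ S^-⊖ m' X (S X) k ⟨
        S^ m' (X ⊖ S X) k        ≡⟨ S^-cong m' xp-top k ⟩
        S^ m' (S K) k            ≡⟨ S^-S m' K k ⟩
        S (S^ m' K) k ∎

    ∼-hi : ∀ r i → r ℕ.+ i ≡ m' → S^ r (hi# r (suc i)) ∼[ i ] hi⁻ r (suc i)
    ∼-hi r zero eq with refl ← trans (sym (ℕₚ.+-identityʳ r)) eq = ∼-top
    ∼-hi r (suc i) eq = ∼-step {i} {w = hi⁻ r (suc (suc i))} (λ n → sym (hi-prev r (suc i) eq n))
      (∼-hi (suc r) i (trans (sym (ℕₚ.+-suc r i)) eq))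

    ∼-lo : ∀ j g → j ℕ.+ g ≡ e → lo# j g ∼[ g ℕ.+ m' ] lo⁻ j g
    ∼-lo j zero eq with refl ← trans (sym (ℕₚ.+-identityʳ j)) eq = ∼-hi 0 m' refl
    ∼-lo j (suc g) eq = ∼-step {g ℕ.+ m'} {w = lo⁻ j (suc g)} (lo-step j g) (∼-lo (suc j) g (trans (sym (ℕₚ.+-suc j g)) eq))

    lo-⊛-D : lo# 0 e ⊛ D (e ℕ.+ m') ≗ N (e ℕ.+ m')
    lo-⊛-D n = trans (∼-lo 0 e refl n) (⊛-δˡ (N (e ℕ.+ m')) n)

  -- Binomial coefficients

  nC0≡1 : ∀ n → n C 0 ≡ 1
  nC0≡1 n = trans (nCk≡nC[n∸k] {0} {n} z≤n) (nCn≡1 n)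

  C-absorb : ∀ r k → suc k ℕ.* ((r ℕ.+ k) C suc k) ≡ r ℕ.* ((r ℕ.+ k) C k)
  C-absorb zero k = trans (cong (suc k ℕ.*_) (k>n⇒nCk≡0 (ℕₚ.n<1+n k))) (ℕₚ.*-zeroʳ (suc k))
  C-absorb (suc r) zero = begin
    1 ℕ.* ((suc r ℕ.+ 0) C 1)       ≡⟨ cong (1 ℕ.*_) (trans (nC1≡n (suc r ℕ.+ 0)) (ℕₚ.+-identityʳ (suc r))) ⟩
    1 ℕ.* suc r                     ≡⟨ ℕₚ.*-comm 1 (suc r) ⟩
    suc r ℕ.* 1                     ≡⟨ cong (suc r ℕ.*_) (nC0≡1 (suc r ℕ.+ 0)) ⟨
    suc r ℕ.* ((suc r ℕ.+ 0) C 0)   ∎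
  C-absorb (suc r) (suc k) = begin
    suc (suc k) ℕ.* (suc n C suc (suc k))
      ≡⟨ cong (suc (suc k) ℕ.*_) (nCk+nC[k+1]≡[n+1]C[k+1] n (suc k)) ⟨
    suc (suc k) ℕ.* ((n C suc k) ℕ.+ (n C suc (suc k)))
      ≡⟨ ℕₚ.*-distribˡ-+ (suc (suc k)) (n C suc k) _ ⟩
    suc (suc k) ℕ.* (n C suc k) ℕ.+ suc (suc k) ℕ.* (n C suc (suc k))
      ≡⟨ cong (suc (suc k) ℕ.* (n C suc k) ℕ.+_) (C-absorb r (suc k)) ⟩
    suc (suc k) ℕ.* (n C suc k) ℕ.+ r ℕ.* (n C suc k)
      ≡⟨ regroup k r (n C suc k) ⟩
    suc k ℕ.* (n C suc k) ℕ.+ suc r ℕ.* (n C suc k)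
      ≡⟨ cong (ℕ._+ suc r ℕ.* (n C suc k))
           (subst (λ z → suc k ℕ.* (z C suc k) ≡ suc r ℕ.* (z C k)) (sym (ℕₚ.+-suc r k)) (C-absorb (suc r) k)) ⟩
    suc r ℕ.* (n C k) ℕ.+ suc r ℕ.* (n C suc k)
      ≡⟨ ℕₚ.*-distribˡ-+ (suc r) (n C k) _ ⟨
    suc r ℕ.* ((n C k) ℕ.+ (n C suc k))
      ≡⟨ cong (suc r ℕ.*_) (nCk+nC[k+1]≡[n+1]C[k+1] n k) ⟩
    suc r ℕ.* (suc n C suc k) ∎
    where
    n = r ℕ.+ suc k
    regroup : ∀ k r c → suc (suc k) ℕ.* c ℕ.+ r ℕ.* c ≡ suc k ℕ.* c ℕ.+ suc r ℕ.* c
    regroup = ℕ-solve-∀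

  -- Ballot numbers

  -- The coefficients of c^(j+1) for the Catalan series c: the clauses express c = 1 + x c^2 and
  -- c^(j+2) = c^(j+1) + x c^(j+3).
  ballot : ℕ → ℕ → ℕ
  ballot j zero = 1
  ballot zero (suc l) = ballot 1 l
  ballot (suc j) (suc l) = ballot j (suc l) ℕ.+ ballot (suc (suc j)) l

  -- The binomial coefficient at k - 1; truncated subtraction would give 1 instead of 0 at k = 0.
  C⁻ : ℕ → ℕ → ℕ
  C⁻ n zero = 0
  C⁻ n (suc k) = n C k

  pascal⁻ : ∀ n k → C⁻ n k ℕ.+ n C k ≡ suc n C k
  pascal⁻ n zero = trans (nC0≡1 n) (sym (nC0≡1 (suc n)))
  pascal⁻ n (suc k) = nCk+nC[k+1]≡[n+1]C[k+1] n k

  -- The reflection formula, as a sum to avoid subtraction. Pascal's rule matches the recursion; for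
  -- `j = 0` the missing step is the symmetry of the two middle coefficients in row 2l + 1.
  ballot-closed : ∀ j l → ballot j l ℕ.+ C⁻ ((l ℕ.+ l) ℕ.+ j) l ≡ ((l ℕ.+ l) ℕ.+ j) C l
  ballot-closed j zero = sym (nC0≡1 j)
  ballot-closed zero (suc l) = begin
    ballot 1 l ℕ.+ (suc n C l)              ≡⟨ cong (ballot 1 l ℕ.+_) (pascal⁻ n l) ⟨
    ballot 1 l ℕ.+ (C⁻ n l ℕ.+ n C l)       ≡⟨ ℕₚ.+-assoc (ballot 1 l) (C⁻ n l) (n C l) ⟨
    ballot 1 l ℕ.+ C⁻ n l ℕ.+ n C l         ≡⟨ cong (ℕ._+ n C l) (subst (λ z → ballot 1 l ℕ.+ C⁻ z l ≡ z C l) n≡ (ballot-closed 1 l)) ⟩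
    n C l ℕ.+ n C l                         ≡⟨ cong (n C l ℕ.+_) mid ⟩
    n C l ℕ.+ n C suc l                     ≡⟨ nCk+nC[k+1]≡[n+1]C[k+1] n l ⟩
    suc n C suc l ∎
    where
    n = (l ℕ.+ suc l) ℕ.+ 0
    n≡ : (l ℕ.+ l) ℕ.+ 1 ≡ n
    n≡ = lemma l
      where lemma : ∀ l → (l ℕ.+ l) ℕ.+ 1 ≡ (l ℕ.+ suc l) ℕ.+ 0
            lemma = ℕ-solve-∀
    mid : n C l ≡ n C suc l
    mid = trans (nCk≡nC[n∸k] {l} {n} (ℕₚ.≤-trans (ℕₚ.m≤m+n l (suc l)) (ℕₚ.m≤m+n _ 0)))
                (cong (n C_) (trans (cong (_∸ l) (ℕₚ.+-identityʳ (l ℕ.+ suc l))) (ℕₚ.m+n∸m≡n l (suc l))))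
  ballot-closed (suc j) (suc l) = begin
    (ballot j (suc l) ℕ.+ ballot (suc (suc j)) l) ℕ.+ (suc n C l)
      ≡⟨ cong ((ballot j (suc l) ℕ.+ ballot (suc (suc j)) l) ℕ.+_) (pascal⁻ n l) ⟨
    (ballot j (suc l) ℕ.+ ballot (suc (suc j)) l) ℕ.+ (C⁻ n l ℕ.+ n C l)
      ≡⟨ lemma (ballot j (suc l)) (ballot (suc (suc j)) l) (C⁻ n l) (n C l) ⟩
    (ballot (suc (suc j)) l ℕ.+ C⁻ n l) ℕ.+ (ballot j (suc l) ℕ.+ n C l)
      ≡⟨ cong₂ ℕ._+_ (subst (λ z → ballot (suc (suc j)) l ℕ.+ C⁻ z l ≡ z C l) n≡₁ (ballot-closed (suc (suc j)) l))
                     (subst (λ z → ballot j (suc l) ℕ.+ z C l ≡ z C suc l) n≡₂ (ballot-closed j (suc l))) ⟩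
    n C l ℕ.+ n C suc l
      ≡⟨ nCk+nC[k+1]≡[n+1]C[k+1] n l ⟩
    suc n C suc l ∎
    where
    n = (l ℕ.+ suc l) ℕ.+ suc j
    n≡₁ : (l ℕ.+ l) ℕ.+ suc (suc j) ≡ n
    n≡₁ = go l j
      where go : ∀ l j → (l ℕ.+ l) ℕ.+ suc (suc j) ≡ (l ℕ.+ suc l) ℕ.+ suc j
            go = ℕ-solve-∀
    n≡₂ : (suc l ℕ.+ suc l) ℕ.+ j ≡ n
    n≡₂ = go l j
      where go : ∀ l j → (suc l ℕ.+ suc l) ℕ.+ j ≡ (l ℕ.+ suc l) ℕ.+ suc j
            go = ℕ-solve-∀
    lemma : ∀ a b c d → (a ℕ.+ b) ℕ.+ (c ℕ.+ d) ≡ (b ℕ.+ c) ℕ.+ (a ℕ.+ d)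
    lemma = ℕ-solve-∀

  ballot-catalan : ∀ l → ballot 0 l ≡ ((l ℕ.+ l) C l) ℕ./ suc l
  ballot-catalan l = begin
    ballot 0 l                         ≡⟨ m*n/n≡m (ballot 0 l) (suc l) ⟨
    ballot 0 l ℕ.* suc l ℕ./ suc l     ≡⟨ cong (ℕ._/ suc l) (main l) ⟩
    ((l ℕ.+ l) C l) ℕ./ suc l ∎
    where
    closed : ∀ l → ballot 0 l ℕ.+ C⁻ (l ℕ.+ l) l ≡ (l ℕ.+ l) C l
    closed l = subst (λ z → ballot 0 l ℕ.+ C⁻ z l ≡ z C l) (ℕₚ.+-identityʳ (l ℕ.+ l)) (ballot-closed 0 l)
    main : ∀ l → ballot 0 l ℕ.* suc l ≡ (l ℕ.+ l) C l
    main zero = refl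
    -- The absorption identity (l + 1) C(2l+2, l+1) = (l + 2) C(2l+2, l) trades the subtracted
    -- coefficient for the central one, so that the reflection formula applies.
    main (suc l) = ℕₚ.+-cancelʳ-≡ (suc l ℕ.* c) _ _ (begin
      b ℕ.* suc (suc l) ℕ.+ suc l ℕ.* c
        ≡⟨ cong (b ℕ.* suc (suc l) ℕ.+_)
             (subst (λ z → suc l ℕ.* (z C suc l) ≡ suc (suc l) ℕ.* (z C l)) n≡ (C-absorb (suc (suc l)) l)) ⟩
      b ℕ.* suc (suc l) ℕ.+ suc (suc l) ℕ.* c⁻
        ≡⟨ lemma b (suc (suc l)) c⁻ ⟩
      suc (suc l) ℕ.* (b ℕ.+ c⁻)
        ≡⟨ cong (suc (suc l) ℕ.*_) (closed (suc l)) ⟩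
      c ℕ.+ suc l ℕ.* c ∎)
      where
      b = ballot 0 (suc l)
      c = (suc l ℕ.+ suc l) C suc l
      c⁻ = (suc l ℕ.+ suc l) C l
      n≡ : suc (suc l) ℕ.+ l ≡ suc l ℕ.+ suc l
      n≡ = cong suc (sym (ℕₚ.+-suc l l))
      lemma : ∀ b k c → b ℕ.* k ℕ.+ k ℕ.* c ≡ k ℕ.* (b ℕ.+ c)
      lemma = ℕ-solve-∀

  -- Coefficients of V

  -- Pascal's rule in row m - j. For j > m truncated subtraction could spoil it, but then all three
  -- coefficients vanish.
  C-diagonal : ∀ m j → ((m ∸ j) C j) ℕ.+ ((m ∸ j) C suc j) ≡ (suc m ∸ j) C suc j
  C-diagonal m j with j ℕ.≤? m
  ... | yes j≤m = trans (nCk+nC[k+1]≡[n+1]C[k+1] (m ∸ j) j) (cong (_C suc j) (sym (ℕₚ.+-∸-assoc 1 j≤m)))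
  ... | no j≰m = begin
    ((m ∸ j) C j) ℕ.+ ((m ∸ j) C suc j)
      ≡⟨ cong₂ ℕ._+_ (k>n⇒nCk≡0 0<) (k>n⇒nCk≡0 (ℕₚ.m<n⇒m<1+n 0<)) ⟩
    0
      ≡⟨ k>n⇒nCk≡0 (subst (ℕ._< suc j) (sym (ℕₚ.m≤n⇒m∸n≡0 m<j)) (s≤s z≤n)) ⟨
    (suc m ∸ j) C suc j ∎
    where
    m<j = ℕₚ.≰⇒> j≰m
    0< : m ∸ j ℕ.< j
    0< = subst (ℕ._< j) (sym (ℕₚ.m≤n⇒m∸n≡0 (ℕₚ.<⇒≤ m<j))) (ℕₚ.≤-trans (s≤s z≤n) m<j)

  V-coeff : ∀ m j → V m j ≡ sign j * (+ ((m ∸ j) C j))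
  V-coeff zero zero = refl
  V-coeff zero (suc j) = sym (*-zeroʳ (- sign j))
  V-coeff (suc zero) zero = refl
  V-coeff (suc zero) (suc j) rewrite ℕₚ.0∸n≡0 j = sym (*-zeroʳ (- sign j))
  V-coeff (suc (suc m)) zero = trans (+-identityʳ (V (suc m) 0))
    (trans (V-coeff (suc m) 0) (cong (λ z → + 1 * + z) (trans (nC0≡1 (suc m)) (sym (nC0≡1 (suc (suc m)))))))
  V-coeff (suc (suc m)) (suc j) = begin
    V (suc m) (suc j) - V m j
      ≡⟨ cong₂ _-_ (V-coeff (suc m) (suc j)) (V-coeff m j) ⟩
    - sign j * + ((m ∸ j) C suc j) - sign j * + ((m ∸ j) C j)
      ≡⟨ lemma (sign j) (+ ((m ∸ j) C suc j)) (+ ((m ∸ j) C j)) ⟩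
    - sign j * + (((m ∸ j) C j) ℕ.+ ((m ∸ j) C suc j))
      ≡⟨ cong (λ z → - sign j * + z) (C-diagonal m j) ⟩
    - sign j * + ((suc m ∸ j) C suc j) ∎
    where lemma : ∀ s a b → - s * a - s * b ≡ - s * (b + a)
          lemma = solve-∀

  V-vanish : ∀ m j → m ℕ.< j ℕ.+ j → V m j ≡ + 0
  V-vanish m j m<2j = trans (V-coeff m j) (trans (cong (λ z → sign j * + z) (k>n⇒nCk≡0 m∸j<j)) (*-zeroʳ (sign j)))
    where
    m∸j<j : m ∸ j ℕ.< j
    m∸j<j with ℕₚ.≤-total j m
    ... | inj₁ j≤m = ℕₚ.+-cancelʳ-< j (m ∸ j) j (subst (ℕ._< j ℕ.+ j) (sym (ℕₚ.m∸n+n≡m j≤m)) m<2j)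
    ... | inj₂ m≤j = subst (ℕ._< j) (sym (ℕₚ.m≤n⇒m∸n≡0 m≤j)) (positive j m<2j)
      where
      positive : ∀ j → m ℕ.< j ℕ.+ j → 0 ℕ.< j
      positive (suc j) _ = s≤s z≤n

  V-vanish-< : ∀ m j → m ℕ.< j → V m j ≡ + 0
  V-vanish-< m j m<j = V-vanish m j (ℕₚ.≤-trans m<j (ℕₚ.m≤m+n j j))

  -- Convolutions as truncated sums

  ⊛-last : ∀ f c n → (f ⊛ c) (suc n) ≡ (f ⊛ (λ i → c (suc i))) n + f (suc n) * c 0
  ⊛-last f c zero = refl
  ⊛-last f c (suc n) = trans
    (cong (_+_ (f 0 * c (suc (suc n)))) (⊛-last (λ i → f (suc i)) c n))
    (sym (+-assoc (f 0 * c (suc (suc n))) (((λ i → f (suc i)) ⊛ (λ i → c (suc i))) n) (f (suc (suc n)) * c 0)))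

  ⊛-comm : ∀ f c → f ⊛ c ≗ c ⊛ f
  ⊛-comm f c zero = *-comm (f 0) (c 0)
  ⊛-comm f c (suc n) = begin
    f 0 * c (suc n) + ((λ i → f (suc i)) ⊛ c) n  ≡⟨ cong₂ _+_ (*-comm (f 0) (c (suc n))) (⊛-comm (λ i → f (suc i)) c n) ⟩
    c (suc n) * f 0 + (c ⊛ (λ i → f (suc i))) n  ≡⟨ +-comm (c (suc n) * f 0) _ ⟩
    (c ⊛ (λ i → f (suc i))) n + c (suc n) * f 0  ≡⟨ ⊛-last c f n ⟨
    (c ⊛ f) (suc n) ∎

  Σℤ<-suc : ∀ m f → Σℤ< (suc m) f ≡ f 0 + Σℤ< m (λ i → f (suc i))
  Σℤ<-suc m f = trans (cong (foldr _+_ (+ 0)) (Listₚ.map-upTo f (suc m)))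
    (cong (λ l → f 0 + foldr _+_ (+ 0) l) (sym (Listₚ.map-upTo (λ i → f (suc i)) m)))

  Σℤ<-cong : ∀ m {f g} → f ≗ g → Σℤ< m f ≡ Σℤ< m g
  Σℤ<-cong zero h = refl
  Σℤ<-cong (suc m) {f} {g} h = trans (Σℤ<-suc m f)
    (trans (cong₂ _+_ (h 0) (Σℤ<-cong m (λ i → h (suc i)))) (sym (Σℤ<-suc m g)))

  ⊛-vanish : ∀ c f n → (∀ i → i ℕ.≤ n → c i ≡ + 0) → (c ⊛ f) n ≡ + 0
  ⊛-vanish c f zero h = cong (_* f 0) (h 0 z≤n)
  ⊛-vanish c f (suc n) h = cong₂ _+_ (cong (_* f (suc n)) (h 0 z≤n)) (⊛-vanish (λ i → c (suc i)) f n (λ i l → h (suc i) (s≤s l)))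

  -- The bound on `K` guarantees that `n ∸ j` is a true difference for each `j` in the sum.
  ⊛-truncate : ∀ K c f n → K ℕ.≤ suc n → (∀ j → K ℕ.≤ j → c j ≡ + 0) →
               (c ⊛ f) n ≡ Σℤ< K (λ j → c j * f (n ∸ j))
  ⊛-truncate zero c f n _ h = ⊛-vanish c f n (λ i _ → h i z≤n)
  ⊛-truncate (suc zero) c f zero l h = sym (+-identityʳ (c 0 * f 0))
  ⊛-truncate (suc (suc K)) c f zero (s≤s ()) h
  ⊛-truncate (suc K) c f (suc n) l h = trans
    (cong (_+_ (c 0 * f (suc n))) (⊛-truncate K (λ i → c (suc i)) f n (ℕₚ.≤-pred l) (λ j k → h (suc j) (s≤s k))))
    (sym (Σℤ<-suc K (λ j → c j * f (suc n ∸ j))))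

  -- A series with constant term 1 is invertible, also modulo any power of the variable.
  ⊛-determined : ∀ f c n → c 0 ≡ + 1 → (∀ i → i ℕ.≤ n → (f ⊛ c) i ≡ + 0) → ∀ i → i ℕ.≤ n → f i ≡ + 0
  ⊛-determined f c zero c0 h .zero z≤n = trans (sym (trans (cong (f 0 *_) c0) (*-identityʳ (f 0)))) (h 0 z≤n)
  ⊛-determined f c (suc n) c0 h i l with ℕₚ.m≤n⇒m<n∨m≡n l
  ... | inj₁ i<1+n = ⊛-determined f c n c0 (λ k k≤n → h k (ℕₚ.m≤n⇒m≤1+n k≤n)) i (ℕₚ.≤-pred i<1+n)
  ... | inj₂ refl = begin
    f (suc n)                      ≡⟨ trans (cong (f (suc n) *_) c0) (*-identityʳ (f (suc n))) ⟨
    f (suc n) * c 0                ≡⟨ +-identityˡ (f (suc n) * c 0) ⟨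
    + 0 + f (suc n) * c 0          ≡⟨ cong (_+ f (suc n) * c 0) (⊛-vanish f (λ i → c (suc i)) n
                                         (⊛-determined f c n c0 (λ k k≤n → h k (ℕₚ.m≤n⇒m≤1+n k≤n)))) ⟨
    (f ⊛ (λ i → c (suc i))) n + f (suc n) * c 0 ≡⟨ ⊛-last f c n ⟨
    (f ⊛ c) (suc n)                ≡⟨ h (suc n) ℕₚ.≤-refl ⟩
    + 0 ∎

  -- Agreement with the Catalan numbers

  S^-vanish : ∀ r f n → n ℕ.< r → S^ r f n ≡ + 0
  S^-vanish (suc r) f zero _ = refl
  S^-vanish (suc r) f (suc n) (s≤s l) = S^-vanish r f n l

  -- x^j c(x)^{j+1}, where c is the Catalan generating function.
  tail : ℕ → Series
  tail j = S^ j (λ l → + ballot j l)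

  -- This is x c^2 = c - 1 multiplied by x^(j+1) c^(j+1); it shows that the tails obey the recursion
  -- of `V`.
  tail-step : ∀ j → tail (suc (suc j)) ≗ tail (suc j) ⊖ S (tail j)
  tail-step j n = begin
    S (S^ (suc j) B₂) n                  ≡⟨ S^-S (suc j) B₂ n ⟨
    S^ (suc j) (S B₂) n                  ≡⟨ S^-cong (suc j) step n ⟩
    S^ (suc j) (B₁ ⊖ B₀) n               ≡⟨ S^-⊖ (suc j) B₁ B₀ n ⟩
    S^ (suc j) B₁ n - S (S^ j B₀) n      ∎
    where
    B₀ B₁ B₂ : Series
    B₀ l = + ballot j l
    B₁ l = + ballot (suc j) l
    B₂ l = + ballot (suc (suc j)) l
    step : S B₂ ≗ B₁ ⊖ B₀
    step zero = refl
    step (suc l) = lemma (B₀ (suc l)) (B₂ l)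
      where lemma : ∀ a b → b ≡ (a + b) - a
            lemma = solve-∀

  tail-one : tail 1 ≗ tail 0 ⊖ δ
  tail-one zero = refl
  tail-one (suc n) = sym (+-identityʳ (+ ballot 1 n))

  -- All three terms satisfy the Chebyshev recursion in `j`, so two initial cases suffice. The
  -- quotients of `V j` by `V (suc j)` are the convergents of the continued fraction of c, and the
  -- tail is the error.
  catalan-⊛-V : ∀ j → tail 0 ⊛ V (suc j) ≗ V j ⊕ tail (suc j)
  catalan-⊛-V zero n = begin
    (tail 0 ⊛ δ) n            ≡⟨ ⊛-δʳ (tail 0) n ⟩
    tail 0 n                  ≡⟨ lemma (δ n) (tail 0 n) ⟩
    δ n + (tail 0 n - δ n)    ≡⟨ cong (_+_ (δ n)) (tail-one n) ⟨
    δ n + tail 1 n ∎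
    where lemma : ∀ a b → b ≡ a + (b - a)
          lemma = solve-∀
  catalan-⊛-V (suc zero) n = begin
    (tail 0 ⊛ V 2) n                          ≡⟨ ⊛-V (tail 0) 0 n ⟩
    (tail 0 ⊛ V 1) n - S (tail 0 ⊛ V 0) n     ≡⟨ cong₂ _-_ (catalan-⊛-V 0 n) (S-cong (⊛-δʳ (tail 0)) n) ⟩
    (δ n + tail 1 n) - S (tail 0) n           ≡⟨ +-assoc (δ n) (tail 1 n) (- S (tail 0) n) ⟩
    δ n + (tail 1 n - S (tail 0) n)           ≡⟨ cong (_+_ (δ n)) (tail-step 0 n) ⟨
    δ n + tail 2 n ∎
  catalan-⊛-V (suc (suc j)) n = begin
    (tail 0 ⊛ V (3 ℕ.+ j)) n
      ≡⟨ ⊛-V (tail 0) (suc j) n ⟩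
    (tail 0 ⊛ V (2 ℕ.+ j)) n - S (tail 0 ⊛ V (suc j)) n
      ≡⟨ cong₂ _-_ (catalan-⊛-V (suc j) n) (trans (S-cong (catalan-⊛-V j) n) (S-⊕ (V j) (tail (suc j)) n)) ⟩
    (V (suc j) n + tail (suc (suc j)) n) - (S (V j) n + S (tail (suc j)) n)
      ≡⟨ lemma (V (suc j) n) (tail (suc (suc j)) n) (S (V j) n) (S (tail (suc j)) n) ⟩
    V (suc (suc j)) n + (tail (suc (suc j)) n - S (tail (suc j)) n)
      ≡⟨ cong (_+_ (V (suc (suc j)) n)) (tail-step (suc j) n) ⟨
    V (suc (suc j)) n + tail (3 ℕ.+ j) n ∎
    where lemma : ∀ a b c d → (a + b) - (c + d) ≡ (a - c) + (b - d)
          lemma = solve-∀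

  -- Both parts of `D i` contribute an error divisible by x^(4+i): one directly, the other as x^2
  -- times a multiple of x^(2+i).
  catalan-⊛-D : ∀ i n → n ℕ.< 4 ℕ.+ i → (tail 0 ⊛ D i) n ≡ N i n
  catalan-⊛-D i n l = begin
    (tail 0 ⊛ D i) n
      ≡⟨ ⊛-⊕ʳ (tail 0) (V (4 ℕ.+ i)) (S (S (V (2 ℕ.+ i)))) n ⟩
    (tail 0 ⊛ V (4 ℕ.+ i)) n + (tail 0 ⊛ S (S (V (2 ℕ.+ i)))) n
      ≡⟨ cong₂ _+_ (trans (catalan-⊛-V (3 ℕ.+ i) n)
                     (trans (cong (_+_ (V (3 ℕ.+ i) n)) (S^-vanish (4 ℕ.+ i) (λ l → + ballot (4 ℕ.+ i) l) n l))
                            (+-identityʳ (V (3 ℕ.+ i) n))))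
                   (trans (⊛-Sʳ (tail 0) (S (V (2 ℕ.+ i))) n) (trans (S-cong (⊛-Sʳ (tail 0) (V (2 ℕ.+ i))) n) (second n l))) ⟩
    V (3 ℕ.+ i) n + S (S (V (suc i))) n ∎
    where
    second : ∀ n → n ℕ.< 4 ℕ.+ i → S (S (tail 0 ⊛ V (2 ℕ.+ i))) n ≡ S (S (V (suc i))) n
    second zero _ = refl
    second (suc zero) _ = refl
    second (suc (suc n)) (s≤s (s≤s l)) = trans (catalan-⊛-V (suc i) n)
      (trans (cong (_+_ (V (suc i) n)) (S^-vanish (2 ℕ.+ i) (λ l → + ballot (2 ℕ.+ i) l) n l)) (+-identityʳ (V (suc i) n)))

  D-constant : ∀ i → D i 0 ≡ + 1
  D-constant i = trans (+-identityʳ (V (4 ℕ.+ i) 0)) (trans (V-coeff (4 ℕ.+ i) 0) (cong (λ z → + 1 * + z) (nC0≡1 (4 ℕ.+ i))))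

  -- Below x^(4+i) the series `f` and c have the same product with `D i`, whose constant term is 1.
  catalan-prefix : ∀ f i → f ⊛ D i ≗ N i → ∀ n → n ℕ.< 4 ℕ.+ i → f n ≡ + ballot 0 n
  catalan-prefix f i eq n l = begin
    f n                              ≡⟨ lemma (f n) (tail 0 n) ⟩
    (f n - tail 0 n) + tail 0 n      ≡⟨ cong (_+ tail 0 n) (⊛-determined (f ⊖ tail 0) (D i) n (D-constant i) zeros n ℕₚ.≤-refl) ⟩
    + 0 + tail 0 n                   ≡⟨ +-identityˡ (tail 0 n) ⟩
    + ballot 0 n ∎
    where
    lemma : ∀ a b → a ≡ (a - b) + b
    lemma = solve-∀
    zeros : ∀ k → k ℕ.≤ n → ((f ⊖ tail 0) ⊛ D i) k ≡ + 0
    zeros k k≤n = trans (⊛-⊖ˡ f (tail 0) (D i) k)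
      (i≡j⇒i-j≡0 {(f ⊛ D i) k} {(tail 0 ⊛ D i) k} (trans (eq k) (sym (catalan-⊛-D i k (ℕₚ.≤-trans (s≤s k≤n) l)))))

  -- The linear recurrence

  -- Expanding both terms of `D i` once and regrouping gives (1 - x) V(k-1) - x^3 V(k-4) for k = i +
  -- 4; its three terms become the three sums of the recurrence.
  D-split : ∀ i → D i ≗ V (3 ℕ.+ i) ⊖ S (V (3 ℕ.+ i)) ⊖ S (S (S (V i)))
  D-split i n = begin
    (V (3 ℕ.+ i) n - S (V (2 ℕ.+ i)) n) + S (S (V (2 ℕ.+ i))) n
      ≡⟨ cong (_+_ (V (3 ℕ.+ i) n - S (V (2 ℕ.+ i)) n))
           (trans (S-cong (S-⊖ (V (1 ℕ.+ i)) (S (V i))) n) (S-⊖ (S (V (1 ℕ.+ i))) (S (S (V i))) n)) ⟩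
    (V (3 ℕ.+ i) n - S (V (2 ℕ.+ i)) n) + (S (S (V (1 ℕ.+ i))) n - S (S (S (V i))) n)
      ≡⟨ lemma (V (3 ℕ.+ i) n) (S (V (2 ℕ.+ i)) n) (S (S (V (1 ℕ.+ i))) n) (S (S (S (V i))) n) ⟩
    (V (3 ℕ.+ i) n - (S (V (2 ℕ.+ i)) n - S (S (V (1 ℕ.+ i))) n)) - S (S (S (V i))) n
      ≡⟨ cong (λ z → (V (3 ℕ.+ i) n - z) - S (S (S (V i))) n) (S-⊖ (V (2 ℕ.+ i)) (S (V (1 ℕ.+ i))) n) ⟨
    (V (3 ℕ.+ i) n - S (V (3 ℕ.+ i)) n) - S (S (S (V i))) n ∎
    where lemma : ∀ a b c d → (a - b) + (c - d) ≡ (a - (b - c)) - d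
          lemma = solve-∀

  N-vanish : ∀ i n → 4 ℕ.+ i ℕ.≤ n → N i n ≡ + 0
  N-vanish i (suc (suc n)) (s≤s (s≤s l)) = cong₂ _+_
    (V-vanish-< (3 ℕ.+ i) (suc (suc n)) (s≤s (s≤s l)))
    (V-vanish-< (suc i) n l)

  recurrence : ∀ (x : ℕ → ℕ) i → (λ n → + x n) ⊛ D i ≗ N i → ∀ n → 4 ℕ.+ i ℕ.≤ n →
    Σℤ< (4 ℕ.+ i) (λ j → sign j * (+ ((3 ℕ.+ i ∸ j) C j)) * (+ x (n ∸ j)))
    ≡ Σℤ< (4 ℕ.+ i) (λ j → sign j * (+ ((3 ℕ.+ i ∸ j) C j)) * (+ x (n ∸ 1 ∸ j)))
      + Σℤ< (1 ℕ.+ i) (λ j → sign j * (+ ((i ∸ j) C j)) * (+ x (n ∸ 3 ∸ j)))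
  recurrence x i eq n@(suc (suc (suc k))) l@(s≤s (s≤s (s≤s l′))) = begin
    Σℤ< (4 ℕ.+ i) (λ j → sign j * (+ ((3 ℕ.+ i ∸ j) C j)) * (+ x (n ∸ j)))
      ≡⟨ to-sum (3 ℕ.+ i) n (ℕₚ.m≤n⇒m≤1+n l) ⟨
    A
      ≡⟨ lemma A B G ⟩
    ((A - B) - G) + (B + G)
      -- The bracket is a coefficient of `N i`, which vanishes from x^(4+i) on.
      ≡⟨ cong (_+ (B + G)) (trans (sym split) (trans (eq n) (N-vanish i n l))) ⟩
    + 0 + (B + G)
      ≡⟨ +-identityˡ (B + G) ⟩
    B + G
      ≡⟨ cong₂ _+_ (to-sum (3 ℕ.+ i) (suc (suc k)) l) (to-sum i k (ℕₚ.m≤n⇒m≤1+n l′)) ⟩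
    _ ∎
    where
    f : Series
    f n = + x n
    A = (f ⊛ V (3 ℕ.+ i)) n
    B = (f ⊛ V (3 ℕ.+ i)) (suc (suc k))
    G = (f ⊛ V i) k
    lemma : ∀ a b c → a ≡ ((a - b) - c) + (b + c)
    lemma = solve-∀
    to-sum : ∀ m n → suc m ℕ.≤ suc n → (f ⊛ V m) n ≡ Σℤ< (suc m) (λ j → sign j * (+ ((m ∸ j) C j)) * (+ x (n ∸ j)))
    to-sum m n l = begin
      (f ⊛ V m) n                               ≡⟨ ⊛-comm f (V m) n ⟩
      (V m ⊛ f) n                               ≡⟨ ⊛-truncate (suc m) (V m) f n l (V-vanish-< m) ⟩
      Σℤ< (suc m) (λ j → V m j * f (n ∸ j))     ≡⟨ Σℤ<-cong (suc m) (λ j → cong (_* f (n ∸ j)) (V-coeff m j)) ⟩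
      _ ∎
    split : (f ⊛ D i) n ≡ (A - B) - G
    split = begin
      (f ⊛ D i) n
        ≡⟨ ⊛-congʳ f (D-split i) n ⟩
      (f ⊛ (V (3 ℕ.+ i) ⊖ S (V (3 ℕ.+ i)) ⊖ S (S (S (V i))))) n
        ≡⟨ ⊛-⊖ʳ f (V (3 ℕ.+ i) ⊖ S (V (3 ℕ.+ i))) (S (S (S (V i)))) n ⟩
      (f ⊛ (V (3 ℕ.+ i) ⊖ S (V (3 ℕ.+ i)))) n - (f ⊛ S (S (S (V i)))) n
        ≡⟨ cong₂ _-_ (trans (⊛-⊖ʳ f (V (3 ℕ.+ i)) (S (V (3 ℕ.+ i))) n) (cong (_-_ A) (⊛-Sʳ f (V (3 ℕ.+ i)) n)))
                     (trans (⊛-Sʳ f (S (S (V i))) n) (trans (⊛-Sʳ f (S (V i)) (suc (suc k))) (⊛-Sʳ f (V i) (suc k)))) ⟩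
      (A - B) - G ∎

  -- Rational coefficients and the substitution t = 1/(2√x)

  ι : ℤ → ℚ
  ι z = z ℚ./ 1

  -- Division by 1 normalises through a gcd that is stuck on a variable; the explicit fraction lets
  -- sums and products compute.
  ι-mkℚ : ∀ z → ι z ≡ mkℚ z 0 (Coprimality.sym (Coprimality.1-coprimeTo ℤ.∣ z ∣))
  ι-mkℚ z = ℚₚ.↥p/↧p≡p (mkℚ z 0 (Coprimality.sym (Coprimality.1-coprimeTo ℤ.∣ z ∣)))

  ι-+ : ∀ a b → ι (a + b) ≡ ι a ℚ.+ ι b
  ι-+ a b = sym (trans (cong₂ ℚ._+_ (ι-mkℚ a) (ι-mkℚ b)) (cong ι (cong₂ _+_ (*-identityʳ a) (*-identityʳ b))))

  ι-* : ∀ a b → ι (a * b) ≡ ι a ℚ.* ι b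
  ι-* a b = sym (cong₂ ℚ._*_ (ι-mkℚ a) (ι-mkℚ b))

  Σℚ<-suc : ∀ m f → Σℚ< (suc m) f ≡ f 0 ℚ.+ Σℚ< m (λ i → f (suc i))
  Σℚ<-suc m f = trans (cong (foldr ℚ._+_ ℚ.0ℚ) (Listₚ.map-upTo f (suc m)))
    (cong (λ l → f 0 ℚ.+ foldr ℚ._+_ ℚ.0ℚ l) (sym (Listₚ.map-upTo (λ i → f (suc i)) m)))

  convℚ-ι : ∀ f c b → (∀ j → b j ≡ ι (c j)) → ∀ n → convℚ (λ i → ι (f i)) b n ≡ ι ((f ⊛ c) n)
  convℚ-ι f c b h zero = begin
    ι (f 0) ℚ.* b 0 ℚ.+ ℚ.0ℚ   ≡⟨ ℚₚ.+-identityʳ (ι (f 0) ℚ.* b 0) ⟩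
    ι (f 0) ℚ.* b 0            ≡⟨ cong (ι (f 0) ℚ.*_) (h 0) ⟩
    ι (f 0) ℚ.* ι (c 0)        ≡⟨ ι-* (f 0) (c 0) ⟨
    ι (f 0 * c 0) ∎
  convℚ-ι f c b h (suc n) = begin
    convℚ (λ i → ι (f i)) b (suc n)
      ≡⟨ Σℚ<-suc (suc n) (λ i → ι (f i) ℚ.* b (suc n ∸ i)) ⟩
    ι (f 0) ℚ.* b (suc n) ℚ.+ convℚ (λ i → ι (f (suc i))) b n
      ≡⟨ cong₂ ℚ._+_ (trans (cong (ι (f 0) ℚ.*_) (h (suc n))) (sym (ι-* (f 0) (c (suc n))))) (convℚ-ι (λ i → f (suc i)) c b h n) ⟩
    ι (f 0 * c (suc n)) ℚ.+ ι (((λ i → f (suc i)) ⊛ c) n)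
      ≡⟨ ι-+ (f 0 * c (suc n)) (((λ i → f (suc i)) ⊛ c) n) ⟨
    ι ((f ⊛ c) (suc n)) ∎

  2^ : ℕ → ℤ
  2^ zero = + 1
  2^ (suc i) = + 2 * 2^ i

  2^-halfPow : ∀ i → ι (2^ i) ℚ.* halfPow i ≡ ℚ.1ℚ
  2^-halfPow zero = refl
  2^-halfPow (suc i) = begin
    ι (+ 2 * 2^ i) ℚ.* (ℚ.½ ℚ.* halfPow i)        ≡⟨ cong (ℚ._* (ℚ.½ ℚ.* halfPow i)) (trans (ι-* (+ 2) (2^ i)) (ℚₚ.*-comm (ι (+ 2)) (ι (2^ i)))) ⟩
    (ι (2^ i) ℚ.* ι (+ 2)) ℚ.* (ℚ.½ ℚ.* halfPow i) ≡⟨ ℚₚ.*-assoc (ι (2^ i)) (ι (+ 2)) _ ⟩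
    ι (2^ i) ℚ.* (ι (+ 2) ℚ.* (ℚ.½ ℚ.* halfPow i)) ≡⟨ cong (ι (2^ i) ℚ.*_) (ℚₚ.*-assoc (ι (+ 2)) ℚ.½ (halfPow i)) ⟨
    ι (2^ i) ℚ.* (ℚ.1ℚ ℚ.* halfPow i)              ≡⟨ cong (ι (2^ i) ℚ.*_) (ℚₚ.*-identityˡ (halfPow i)) ⟩
    ι (2^ i) ℚ.* halfPow i                         ≡⟨ 2^-halfPow i ⟩
    ℚ.1ℚ ∎

  chebU-degree : ∀ m i → m ℕ.< i → chebU m i ≡ + 0
  chebU-degree zero (suc i) _ = refl
  chebU-degree (suc zero) (suc (suc i)) _ = refl
  chebU-degree (suc zero) (suc zero) (s≤s ())
  chebU-degree (suc (suc m)) (suc i) (s≤s l) = cong₂ (λ a b → + 2 * a - b)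
    (chebU-degree (suc m) i l)
    (chebU-degree m (suc i) (ℕₚ.m≤n⇒m≤1+n (ℕₚ.≤-trans (ℕₚ.n≤1+n (suc m)) l)))

  -- Each power of t in `chebU` comes with a factor 2, and each subtraction lowers the degree by
  -- two, which accounts for one power of x. The factor 2^i is what `halfPow` cancels.
  chebU-V : ∀ m i j → i ℕ.+ (j ℕ.+ j) ≡ m → chebU m i ≡ 2^ i * V m j
  chebU-V zero zero zero refl = refl
  chebU-V (suc zero) (suc zero) zero refl = refl
  chebU-V (suc zero) zero (suc j) eq with () ← trans (sym (ℕₚ.+-suc j j)) (ℕₚ.suc-injective eq)
  chebU-V (suc zero) (suc (suc i)) j ()
  chebU-V (suc zero) (suc zero) (suc j) ()
  chebU-V (suc (suc m)) zero (suc j) eq = begin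
    - chebU m 0                              ≡⟨ cong -_ (chebU-V m 0 j eq′) ⟩
    - (+ 1 * V m j)                          ≡⟨ lemma (V m j) ⟩
    + 1 * (+ 0 - V m j)                      ≡⟨ cong (λ z → + 1 * (z - V m j)) (V-vanish (suc m) (suc j) (ℕₚ.≤-reflexive (sym eq))) ⟨
    + 1 * (V (suc m) (suc j) - V m j) ∎
    where
    eq′ : j ℕ.+ j ≡ m
    eq′ = ℕₚ.suc-injective (trans (sym (ℕₚ.+-suc j j)) (ℕₚ.suc-injective eq))
    lemma : ∀ a → - (+ 1 * a) ≡ + 1 * (+ 0 - a)
    lemma = solve-∀
  chebU-V (suc (suc m)) (suc i) zero eq = begin
    + 2 * chebU (suc m) i - chebU m (suc i)
      ≡⟨ cong₂ (λ a b → + 2 * a - b) (chebU-V (suc m) i 0 (ℕₚ.suc-injective eq))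
               (chebU-degree m (suc i) (ℕₚ.≤-trans (ℕₚ.n≤1+n (suc m)) (ℕₚ.≤-reflexive (trans (sym eq) (cong suc (ℕₚ.+-identityʳ i)))))) ⟩
    + 2 * (2^ i * V (suc m) 0) - + 0
      ≡⟨ lemma (2^ i) (V (suc m) 0) ⟩
    + 2 * 2^ i * (V (suc m) 0 - + 0) ∎
    where lemma : ∀ a b → + 2 * (a * b) - + 0 ≡ + 2 * a * (b - + 0)
          lemma = solve-∀
  chebU-V (suc (suc m)) (suc i) (suc j) eq = begin
    + 2 * chebU (suc m) i - chebU m (suc i)
      ≡⟨ cong₂ (λ a b → + 2 * a - b) (chebU-V (suc m) i (suc j) (ℕₚ.suc-injective eq)) (chebU-V m (suc i) j eq′) ⟩
    + 2 * (2^ i * V (suc m) (suc j)) - + 2 * 2^ i * V m j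
      ≡⟨ lemma (2^ i) (V (suc m) (suc j)) (V m j) ⟩
    + 2 * 2^ i * (V (suc m) (suc j) - V m j) ∎
    where
    eq′ : suc i ℕ.+ (j ℕ.+ j) ≡ m
    eq′ = ℕₚ.suc-injective (ℕₚ.suc-injective (trans (cong (ℕ._+_ 2) (trans (sym (ℕₚ.+-suc i (j ℕ.+ j))) (cong (i ℕ.+_) (sym (ℕₚ.+-suc j j)))))
              (trans (cong suc (sym (ℕₚ.+-suc i (j ℕ.+ suc j)))) eq)))
    lemma : ∀ a b c → + 2 * (a * b) - + 2 * a * c ≡ + 2 * a * (b - c)
    lemma = solve-∀

  subHalf-V : ∀ m j → subHalf m (chebU m) j ≡ ι (V m j)
  subHalf-V m j with (j ℕ.+ j) ℕ.≤? m
  ... | yes le = begin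
    ι (chebU m i) ℚ.* halfPow i               ≡⟨ cong (λ z → ι z ℚ.* halfPow i) (trans (chebU-V m i j (ℕₚ.m∸n+n≡m le)) (*-comm (2^ i) (V m j))) ⟩
    ι (V m j * 2^ i) ℚ.* halfPow i            ≡⟨ cong (ℚ._* halfPow i) (ι-* (V m j) (2^ i)) ⟩
    ι (V m j) ℚ.* ι (2^ i) ℚ.* halfPow i      ≡⟨ ℚₚ.*-assoc (ι (V m j)) (ι (2^ i)) (halfPow i) ⟩
    ι (V m j) ℚ.* (ι (2^ i) ℚ.* halfPow i)    ≡⟨ cong (ι (V m j) ℚ.*_) (2^-halfPow i) ⟩
    ι (V m j) ℚ.* ℚ.1ℚ                        ≡⟨ ℚₚ.*-identityʳ (ι (V m j)) ⟩
    ι (V m j) ∎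
    where i = m ∸ (j ℕ.+ j)
  ... | no nle = cong ι (sym (V-vanish m j (ℕₚ.≰⇒> nle)))

  shift2-ι : ∀ q c → (∀ j → q j ≡ ι (c j)) → ∀ j → shift2 q j ≡ ι (S (S c) j)
  shift2-ι q c h zero = refl
  shift2-ι q c h (suc zero) = refl
  shift2-ι q c h (suc (suc j)) = h j

  numer-N : ∀ i j → numer (4 ℕ.+ i) j ≡ ι (N i j)
  numer-N i j = trans
    (cong₂ ℚ._+_ (subHalf-V (3 ℕ.+ i) j) (shift2-ι _ (V (1 ℕ.+ i)) (subHalf-V (1 ℕ.+ i)) j))
    (sym (ι-+ (V (3 ℕ.+ i) j) (S (S (V (1 ℕ.+ i))) j)))

  denom-D : ∀ i j → denom (4 ℕ.+ i) j ≡ ι (D i j)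
  denom-D i j = trans
    (cong₂ ℚ._+_ (subHalf-V (4 ℕ.+ i) j) (shift2-ι _ (V (2 ℕ.+ i)) (subHalf-V (2 ℕ.+ i)) j))
    (sym (ι-+ (V (4 ℕ.+ i) j) (S (S (V (2 ℕ.+ i))) j)))

open import Data.Nat using (ℕ; suc; _+_; _∸_; _≤_; _*_; _/_)
open import Data.Nat.Combinatorics using (_C_)
open import Data.Integer using (+_) renaming (_*_ to _*ℤ_; _+_ to _+ℤ_)
open import Data.Rational using () renaming (_/_ to _/ℚ_)
open import Data.Nat using (s≤s)
open import Data.Nat.Properties using (m≤n⇒∃[o]m+o≡n)
open import Data.Integer.Properties using (+-injective)

theorem3p2 : (k d : ℕ) → 4 ≤ k → 2 ≤ d → d ≤ k ∸ 2 →
    (x : ℕ → ℕ) → (∀ n → Fin (x n) ↔ AvoidingPerm k d n) →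
    ((n : ℕ) → k ≤ n →
    Σℤ< k (λ j → sign j *ℤ (+ ((k ∸ 1 ∸ j) C j)) *ℤ (+ x (n ∸ j)))
    ≡ Σℤ< k (λ j → sign j *ℤ (+ ((k ∸ 1 ∸ j) C j)) *ℤ (+ x (n ∸ 1 ∸ j)))
    +ℤ Σℤ< (k ∸ 3) (λ j → sign j *ℤ (+ ((k ∸ 4 ∸ j) C j)) *ℤ (+ x (n ∸ 3 ∸ j))))
    × ((n : ℕ) → n ≤ k ∸ 1 → x n ≡ ((n + n) C n) / suc n)
    × ((n : ℕ) → convℚ (λ i → (+ x i) /ℚ 1) (denom k) n ≡ numer k n)
theorem3p2 (suc (suc (suc (suc k)))) (suc (suc e)) (s≤s (s≤s (s≤s (s≤s _)))) (s≤s (s≤s _)) (s≤s (s≤s e≤k)) x count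
  -- In the notation of the statement, m' = k - d - 2 and e = d - 2.
  with m' , refl ← m≤n⇒∃[o]m+o≡n e≤k =
    recurrence x i x⊛D
  , (λ n n≤ → trans (+-injective (catalan-prefix (λ n → + x n) i x⊛D n (s≤s n≤))) (ballot-catalan n))
  , (λ n → trans (convℚ-ι (λ n → + x n) (D i) (denom (4 + i)) (denom-D i) n)
             (trans (cong ι (x⊛D n)) (sym (numer-N i n))))
  where
  open GeneratingFunctions
  i = e + m'
  -- The hypothesis on `x` enters only through cardinality: `x n` counts the words accepted from the
  -- start state, without lag or lead.
  x≡ : ∀ n → x n ≡ Bijections.Machine.#lo e m' 0 e n
  x≡ n = ↔⇒≡ (↔-trans (count n) (↔-trans (Bijections.Bijection.bijection e m' n)
    (↔-sym (Bijections.Machine.lo↔ e m' 0 e n refl))))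
  x⊛D : (λ n → + x n) ⊛ D i ≗ N i
  x⊛D n = trans (⊛-congˡ (D i) (λ n → cong +_ (x≡ n)) n) (Count.lo-⊛-D e m' n)
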